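{- Let $N\in\mathbb{N}$ be fixed and let $\mathcal{F}$ be a nonempty collection of $k$-colourings of $E(K_N)$. For any $\varepsilon>0$ there exist constants $C_0,n_0>0$, depending only on $(\varepsilon,k,N)$, such that for any $n\ge n_0$ there exists a collection $\mathcal{T}$ of $k$-colouring templates for $K_n$ satisfying: (i) $\mathcal{T}$ is a container family for $\mathrm{Forb}(\mathcal{F})_n$; (ii) for each template $t\in\mathcal{T}$, there are at most $\varepsilon\binom{n}{N}$ $N$-element sets $A\subseteq[n]$ such that $c\le t_{|A}$ for some $c\in\mathcal{F}$; (iii) $\log_k|\mathcal{T}|\le C_0\, n^{ -1/(2\binom{N}{2}-1)}\binom{n}{2}$.
   Context: $k\ge2$ is a fixed integer and $[k]=\{1,\dots,k\}$. $K_n$ is the complete graph on vertex set $[n]$. A $k$-colouring of $K_n$ (or of $E(K_n)$) is a function $c:E(K_n)\to[k]$. For $A=\{a_1<\dots<a_m\}\subseteq[n]$ the restriction $c_{|A}$ is the $k$-colouring of $K_m$ given by $c_{|A}(ij)=c(a_ia_j)$. A ($k$-colouring) template for $K_n$ is a function $t$ assigning to each edge $e\in E(K_n)$ a nonempty set $t(e)\subseteq[k]$; its restriction $t_{|A}$ is the template for $K_m$ with $t_{|A}(ij)=t(a_ia_j)$. A realisation of $t$ is a $k$-colouring $c$ of $K_n$ with $c(e)\in t(e)$ for all $e$; $\langle t\rangle$ is the set of realisations. For a $k$-colouring $c$ of $K_N$ and an $N$-set $A\subseteq[n]$, $c\le t_{|A}$ means $c(e)\in t_{|A}(e)$ for every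 $e\in E(K_N)$. $\mathrm{Forb}(\mathcal{F})_n$ is the set of $k$-colourings $c$ of $K_n$ such that $c_{|A}\notin\mathcal{F}$ for every $N$-set $A\subseteq[n]$. A container family for a set $\mathcal{G}$ of $k$-colourings of $K_n$ is a collection $\mathcal{T}$ of templates for $K_n$ with $\mathcal{G}\subseteq\bigcup_{t\in\mathcal{T}}\langle t\rangle$. Convention: $\log_k 0=-\infty$. -}

module Defs where

import Algebra.Definitions.RawSemiring as RawSemiringDefs
open import Data.Fin.Base using (Fin; zero; suc; cast; _<_)
open import Data.Fin.Properties using (toℕ-cast)
open import Data.Fin.Subset using (Subset; Nonempty; _∈_; ∣_∣; inside; outside)
open import Data.Integer.Base as ℤ using (ℤ; +_; -[1+_])
open import Data.List.Base using (List; length)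
open import Data.List.Membership.Setoid using () renaming (_∈_ to Member)
open import Data.List.Relation.Unary.All using (All)
open import Data.List.Relation.Unary.Any using (Any)
open import Data.List.Relation.Unary.Unique.Propositional using (Unique)
open import Data.Nat.Base as ℕ using (ℕ; zero; suc; z<s; s<s)
open import Data.Nat.Combinatorics using (_C_)
import Data.Nat.Properties as ℕ
open import Data.Product.Base using (∃-syntax; _×_)
open import Data.Rational.Base as ℚ using (ℚ; 0ℚ; ↥_; ↧ₙ_; 1/_)
open import Data.Rational.Literals using (fromℤ)
open import Data.Sum.Base using (_⊎_)
open import Data.Vec.Base using ([]; _∷_)
open import Function.Bundles using (_⇔_)
open import Level using (0ℓ)
open import Relation.Binary.PropositionalEquality
  using (_≡_; sym; subst₂; _→-setoid_)
open import Relation.Nullary using (¬_)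
open import Relation.Unary using (Pred)

-- An extended real x is represented by the set {q ∈ ℚ ∣ x < q}.  This
-- determines x, and it gives the value −∞ (the full set) to log 0.

Cut : Set₁
Cut = Pred ℚ 0ℓ

infix 4 _≼_

_≼_ : Cut → Cut → Set
x ≼ y = ∀ q → y q → x q

-- Dedekind reals; the Cut of such an x is upper x.

record ℝ : Set₁ where
  field
    lower upper     : Cut
    lower-inhabited : ∃[ q ] lower q
    upper-inhabited : ∃[ q ] upper q
    lower-rounded   : ∀ q → lower q ⇔ (∃[ r ] q ℚ.< r × lower r)
    upper-rounded   : ∀ q → upper q ⇔ (∃[ r ] r ℚ.< q × upper r)
    disjoint        : ∀ q → ¬ (lower q × upper q)
    located         : ∀ q r → q ℚ.< r → lower q ⊎ upper r

Positiveℝ : ℝ → Set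
Positiveℝ x = ℝ.lower x 0ℚ

fromℕ : ℕ → ℚ
fromℕ n = fromℤ (+ n)

⌜_⌝ : ℚ → Cut
⌜ p ⌝ q = p ℚ.< q

-- Multiplication of a finite x by a rational scalar c ≥ 0.

infixl 7 _·_

_·_ : ℚ → Cut → Cut
(c · x) q = ∃[ r ] x r × c ℚ.* r ℚ.< q

open RawSemiringDefs ℚ.+-*-rawSemiring using (_^_)

_^ᶻ_ : (p : ℚ) .{{_ : ℚ.NonZero p}} → ℤ → ℚ
p ^ᶻ (+ m)    = p ^ m
p ^ᶻ -[1+ m ] = (1/ p) ^ suc m

-- The real number n^(a/b), b > 0:  n^(a/b) < q  iff  q > 0 and n^a < q^b.

power : (n : ℕ) .{{_ : ℕ.NonZero n}} → ℚ → Cut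
power n s q = 0ℚ ℚ.< q × (fromℕ n ^ᶻ (↥ s)) ℚ.< (q ^ (↧ₙ s))

-- The extended real log_k m:  log_k m < u/v  iff  m^v < k^u.

log : (k : ℕ) .{{_ : ℕ.NonTrivial k}} → ℕ → Cut
log k m q = (fromℕ m ^ (↧ₙ q)) ℚ.< (fromℕ k ^ᶻ (↥ q))
  where instance
    k≢0 : ℕ.NonZero k
    k≢0 = ℕ.nonTrivial⇒nonZero k

-- "At most x elements satisfy P", without deciding P: every duplicate-free
-- list of such elements has length at most x.

AtMost : {A : Set} → Cut → Pred A 0ℓ → Set
AtMost x P = ∀ xs → Unique xs → All P xs → ⌜ fromℕ (length xs) ⌝ ≼ x

-- 2b − 1 is taken in ℤ: it is −1 when b = 0.

2b-1 : ℕ → ℤ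
2b-1 b = + (2 ℕ.* b) ℤ.- + 1

2b-1≢0 : ∀ b → ℤ.NonZero (2b-1 b)
2b-1≢0 zero    = _
2b-1≢0 (suc b) rewrite ℕ.+-suc b (b ℕ.+ 0) = _

containerExponent : ℕ → ℚ
containerExponent N = ℚ.- (1/_ (fromℤ (2b-1 (N C 2))) {{2b-1≢0 (N C 2)}})

-- The edge {i, j} of Kₙ is stored as the pair (i, j) with i < j.

record Edge (n : ℕ) : Set where
  constructor edge
  field
    i j  : Fin n
    .i<j : i < j

Colouring : ℕ → ℕ → Set
Colouring k n = Edge n → Fin k

record Template (k n : ℕ) : Set where
  field
    colours  : Edge n → Subset k
    nonempty : ∀ e → Nonempty (colours e)

open Template public

infix 4 _∈⟨_⟩

-- On restrictions to N-sets, this is also the relation c ≤ t∣A.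

_∈⟨_⟩ : ∀ {k n} → Colouring k n → Template k n → Set
c ∈⟨ t ⟩ = ∀ e → c e ∈ colours t e

record SetOfSize (N n : ℕ) : Set where
  constructor _of-size_
  field
    set   : Subset n
    .size : ∣ set ∣ ≡ N

-- The elements a₁ < ⋯ < aₘ of A, in increasing order.

enumerate : ∀ {n} (A : Subset n) → Fin ∣ A ∣ → Fin n
enumerate (inside  ∷ A) zero    = zero
enumerate (inside  ∷ A) (suc i) = suc (enumerate A i)
enumerate (outside ∷ A) i       = suc (enumerate A i)

enumerate-mono : ∀ {n} (A : Subset n) {i j} → i < j →
                 enumerate A i < enumerate A j
enumerate-mono (inside  ∷ A) {zero}  {suc j} _         = z<s
enumerate-mono (inside  ∷ A) {suc i} {suc j} (s<s i<j) = s<s (enumerate-mono A i<j)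
enumerate-mono (outside ∷ A) i<j                       = s<s (enumerate-mono A i<j)

element : ∀ {N n} → SetOfSize N n → Fin N → Fin n
element (A of-size ∣A∣≡N) i = enumerate A (cast (sym ∣A∣≡N) i)

element-mono : ∀ {N n} (A : SetOfSize N n) {i j} → i < j →
               element A i < element A j
element-mono (A of-size ∣A∣≡N) {i} {j} i<j = enumerate-mono A
  (subst₂ ℕ._<_ (sym (toℕ-cast (sym ∣A∣≡N) i)) (sym (toℕ-cast (sym ∣A∣≡N) j)) i<j)

embed : ∀ {N n} → SetOfSize N n → Edge N → Edge n
embed A (edge i j i<j) = edge (element A i) (element A j) (element-mono A i<j)

_∣ᶜ_ : ∀ {k N n} → Colouring k n → SetOfSize N n → Colouring k N
(c ∣ᶜ A) e = c (embed A e)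

_∣ᵗ_ : ∀ {k N n} → Template k n → SetOfSize N n → Template k N
t ∣ᵗ A = record
  { colours  = λ e → colours t (embed A e)
  ; nonempty = λ e → nonempty t (embed A e)
  }

-- Colourings are compared pointwise, so that a list of colourings is a
-- finite set of functions on E(K_N).

infix 4 _∈ᶜ_

_∈ᶜ_ : ∀ {k N} → Colouring k N → List (Colouring k N) → Set
_∈ᶜ_ {k} {N} = Member (Edge N →-setoid Fin k)

Forb : ∀ {k N} → List (Colouring k N) → (n : ℕ) → Pred (Colouring k n) 0ℓ
Forb {k} {N} F n c = ∀ (A : SetOfSize N n) → ¬ (c ∣ᶜ A ∈ᶜ F)

IsContainerFamily : ∀ {k n} → List (Template k n) → Pred (Colouring k n) 0ℓ → Set
IsContainerFamily T G = ∀ c → G c → Any (c ∈⟨_⟩) T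

ContainsMemberOf : ∀ {k N n} → List (Colouring k N) → Template k n →
                   Pred (SetOfSize N n) 0ℓ
ContainsMemberOf F t A = ∃[ c ] c ∈ᶜ F × c ∈⟨ t ∣ᵗ A ⟩

{-# OPTIONS --safe #-}

-- Regard a template as the set of its points (edge, colour).  For a template t,
-- a colouring c ∈ ⟨t⟩ and a list es of edges of K_N, let X(es) be the number of
-- maps [N] → [n] that carry some f ∈ F into t and along which c agrees with f
-- on es.  If t contains at least n^N / E copies then X([]) ≥ n^N / E, while
-- X(E(K_N)) = 0 for c ∈ Forb(F).  With q ≈ n^(1/(2b−1)), b = C(N,2), some edge e
-- of K_N therefore lowers X by a factor of at least q² when it is added to a list
-- es with X(es) ≥ n^N / (E q^(2|es|)).  Average over the position φ of the copy:
-- moving only the two ends of e around a suitable φ meets at least n q / 2E points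
-- of t that would complete a copy, of which c realises a fraction at most 2/q².
-- All edges of K_N but e have an end at a fixed vertex, so these points can be
-- read off from φ and the stars of c at φ, which costs O(n) symbols; listing the
-- few realised points is as cheap because log n = O(q), and all the others leave
-- t.  Every removed point is thus paid for with O(1/q) symbols, and a branching
-- process that stops at templates with few copies has k^(O(n²/q)) leaves.

module Submission where

open import Defs
open import Algebra.Bundles using (CommutativeRing)
import Algebra.Definitions.RawSemiring as RawSemiringDefs
import Algebra.Properties.CommutativeSemiring.Exp as Exp
open import Data.Bool.Base using (true; false; if_then_else_)
open import Data.Empty using (⊥-elim; ⊥-elim-irr)
open import Data.Fin.Base as Fin using (Fin; zero; suc; cast)
import Data.Fin.Properties as Fin
open import Data.Fin.Subset using (Subset; ∣_∣; inside; outside) renaming (_∈_ to _∈ˢ_; ⊥ to ∅)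
open import Data.Fin.Subset.Properties using (∣⊥∣≡0)
open import Data.Integer.Base as ℤ using (-[1+_]; +[1+_])
import Data.Integer.Properties as ℤ
open import Data.List.Base
  using (List; []; _∷_; _++_; length; map; filter; cartesianProduct; cartesianProductWith; allFin)
open import Data.List.Membership.Propositional using (_∈_; _∉_; find; lose)
import Data.List.Membership.DecPropositional as DecMembership
open import Data.List.Membership.Propositional.Properties
open import Data.List.Properties using
  (length-++; length-map; length-tabulate; length-filter; filter-≐; filter-none; map-++; map-∘; map-cong)
open import Data.List.Relation.Binary.Subset.Propositional using (_⊆_)
open import Data.List.Relation.Unary.All as All using (All; []; _∷_)
open import Data.List.Relation.Unary.All.Properties using (++⁺)
open import Data.List.Relation.Unary.AllPairs using ([]; _∷_)
open import Data.List.Relation.Unary.Any as Any using (Any; here; there)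
import Data.List.Relation.Unary.Any.Properties as Any
open import Data.List.Relation.Unary.Unique.Propositional using (Unique)
import Data.List.Relation.Unary.Unique.Propositional.Properties as Unique
open import Data.Nat.Base
open import Data.Nat.Combinatorics using (_C_; nC1≡n; nCk+nC[k+1]≡[n+1]C[k+1]; k>n⇒nCk≡0)
open import Data.Nat.Divisibility using (divides-refl)
open import Data.Nat.DivMod using (_/_; m/n*n≤m; m*n/n≡m; /-monoˡ-≤; +-distrib-/-∣ˡ)
open import Data.Nat.Induction using (<-wellFounded)
open import Data.Nat.ListAction using (sum)
open import Data.Nat.ListAction.Properties using (sum-++)
open import Data.Nat.Properties
open import Data.Nat.Tactic.RingSolver using (solve-∀)
open import Data.Product.Base using (∃-syntax; ∃₂; _×_; _,_; proj₁; proj₂; uncurry; map₂)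
open import Data.Product.Properties using (≡-dec)
open import Data.Rational.Base as ℚ using (ℚ; mkℚ; 0ℚ; 1ℚ; 1/_; *<*; *≤*)
import Data.Rational.Properties as ℚ
open import Data.Rational.Literals using (fromℤ)
open import Data.Rational.Unnormalised.Base using (*≡*)
import Data.Rational.Unnormalised.Properties as ℚᵘ
open import Data.Sum.Base using (_⊎_; inj₁; inj₂)
open import Data.Vec.Base as Vec using (Vec; []; _∷_; _[_]≔_; lookup)
open import Data.Vec.Properties
  using (lookup∘tabulate; lookup∘update; lookup∘update′; lookup⇒[]=; []=⇒lookup)
open import Function.Base
open import Function.Bundles using (Equivalence)
open import Induction.WellFounded using (Acc; acc)
open import Level using (Level; 0ℓ)
open import Relation.Binary.Definitions using (DecidableEquality; tri<; tri≈; tri>)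
open import Relation.Binary.PropositionalEquality
open import Relation.Nullary
open import Relation.Nullary.Decidable using (dec-true)
open import Relation.Unary using (Pred; Decidable)
open RawSemiringDefs ℚ.+-*-rawSemiring using () renaming (_^_ to _^ᵠ_)
open Exp (CommutativeRing.commutativeSemiring ℚ.+-*-commutativeRing) using (^-distrib-*)

private
  variable
    ℓ : Level
    A B : Set ℓ
    P : Pred A ℓ

-- Finite sums and counting in lists.

∑ : List A → (A → ℕ) → ℕ
∑ xs f = sum (map f xs)

𝟙 : Dec A → ℕ
𝟙 A? = if does A? then 1 else 0

∑-cong : ∀ (xs : List A) {f g : A → ℕ} → (∀ x → f x ≡ g x) → ∑ xs f ≡ ∑ xs g
∑-cong xs f≗g = cong sum (map-cong f≗g xs)

∑-++ : ∀ (xs ys : List A) f → ∑ (xs ++ ys) f ≡ ∑ xs f + ∑ ys f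
∑-++ xs ys f = trans (cong sum (map-++ f xs ys)) (sum-++ (map f xs) (map f ys))

∑-map : ∀ (h : A → B) xs f → ∑ (map h xs) f ≡ ∑ xs (f ∘ h)
∑-map h xs f = cong sum (sym (map-∘ xs))

∑-*ˡ : ∀ a (xs : List A) f → ∑ xs (λ x → a * f x) ≡ a * ∑ xs f
∑-*ˡ a []       f = sym (*-zeroʳ a)
∑-*ˡ a (x ∷ xs) f = trans (cong (a * f x +_) (∑-*ˡ a xs f)) (sym (*-distribˡ-+ a (f x) (∑ xs f)))

∑-+ : ∀ (xs : List A) f g → ∑ xs (λ x → f x + g x) ≡ ∑ xs f + ∑ xs g
∑-+ []       f g = refl
∑-+ (x ∷ xs) f g = begin
  f x + g x + ∑ xs (λ x → f x + g x)  ≡⟨ cong (f x + g x +_) (∑-+ xs f g) ⟩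
  f x + g x + (∑ xs f + ∑ xs g)       ≡⟨ interchange (f x) (g x) (∑ xs f) (∑ xs g) ⟩
  f x + ∑ xs f + (g x + ∑ xs g)       ∎
  where
  open ≡-Reasoning
  interchange : ∀ a b c d → a + b + (c + d) ≡ a + c + (b + d)
  interchange = solve-∀

∑-const : ∀ (xs : List A) a → ∑ xs (const a) ≡ length xs * a
∑-const []       a = refl
∑-const (x ∷ xs) a = cong (a +_) (∑-const xs a)

∑-comm : ∀ (xs : List A) (ys : List B) (f : A → B → ℕ) →
         ∑ xs (λ x → ∑ ys (f x)) ≡ ∑ ys (λ y → ∑ xs (λ x → f x y))
∑-comm []       ys f = sym (trans (∑-const ys 0) (*-zeroʳ (length ys)))
∑-comm (x ∷ xs) ys f = trans (cong (∑ ys (f x) +_) (∑-comm xs ys f)) (sym (∑-+ ys (f x) _))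

∑-<⇒∃ : ∀ (xs : List A) f g → ∑ xs f < ∑ xs g → ∃[ x ] x ∈ xs × f x < g x
∑-<⇒∃ (x ∷ xs) f g ∑f<∑g with f x <? g x
... | yes fx<gx = x , here refl , fx<gx
... | no  fx≮gx with ∑-<⇒∃ xs f g (≰⇒> λ ∑g≤∑f → <⇒≱ ∑f<∑g (+-mono-≤ (≮⇒≥ fx≮gx) ∑g≤∑f))
...   | y , y∈xs , fy<gy = y , there y∈xs , fy<gy

∑-cartesianProductWith : ∀ {C : Set ℓ} (h : A → B → C) xs ys f →
  ∑ (cartesianProductWith h xs ys) f ≡ ∑ xs (λ x → ∑ ys (λ y → f (h x y)))
∑-cartesianProductWith h []       ys f = refl
∑-cartesianProductWith h (x ∷ xs) ys f =
  trans (∑-++ (map (h x) ys) _ f) (cong₂ _+_ (∑-map (h x) ys f) (∑-cartesianProductWith h xs ys f))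

length-cartesianProductWith : ∀ {C : Set ℓ} (h : A → B → C) xs ys →
  length (cartesianProductWith h xs ys) ≡ length xs * length ys
length-cartesianProductWith h []       ys = refl
length-cartesianProductWith h (x ∷ xs) ys =
  trans (length-++ (map (h x) ys)) (cong₂ _+_ (length-map (h x) ys) (length-cartesianProductWith h xs ys))

length-filter≡∑ : ∀ (P? : Decidable P) xs → length (filter P? xs) ≡ ∑ xs (𝟙 ∘ P?)
length-filter≡∑ P? []       = refl
length-filter≡∑ P? (x ∷ xs) with does (P? x)
... | true  = cong suc (length-filter≡∑ P? xs)
... | false = length-filter≡∑ P? xs

-- Delete an occurrence of `x` from `ys`: by uniqueness the tail of `xs` avoids `x`, so it is still
-- included in what remains.
Unique-⊆⇒length-≤ : ∀ {xs ys : List A} → Unique xs → xs ⊆ ys → length xs ≤ length ys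
Unique-⊆⇒length-≤ {xs = []} _ _ = z≤n
Unique-⊆⇒length-≤ {xs = x ∷ xs} {ys} uxs@(_ ∷ u) xs⊆ys
  with ys₁ , ys₂ , refl ← ∈-∃++ (xs⊆ys (here refl)) = begin
  suc (length xs)                ≤⟨ s≤s (Unique-⊆⇒length-≤ u xs⊆ys₁++ys₂) ⟩
  suc (length (ys₁ ++ ys₂))      ≡⟨ cong suc (length-++ ys₁) ⟩
  suc (length ys₁ + length ys₂)  ≡⟨ +-suc _ _ ⟨
  length ys₁ + suc (length ys₂)  ≡⟨ length-++ ys₁ ⟨
  length (ys₁ ++ x ∷ ys₂)        ∎
  where
  open ≤-Reasoning
  xs⊆ys₁++ys₂ : xs ⊆ ys₁ ++ ys₂
  xs⊆ys₁++ys₂ y∈xs with ∈-++⁻ ys₁ (xs⊆ys (there y∈xs))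
  ... | inj₁ y∈ys₁         = ∈-++⁺ˡ y∈ys₁
  ... | inj₂ (here refl)   = ⊥-elim (Unique.Unique[x∷xs]⇒x∉xs uxs y∈xs)
  ... | inj₂ (there y∈ys₂) = ∈-++⁺ʳ ys₁ y∈ys₂

length-allFin : ∀ n → length (allFin n) ≡ n
length-allFin n = length-tabulate {n = n} id

-- Enumerations of vectors, short sublists and suffixes.

vecs : List A → ∀ m → List (Vec A m)
vecs xs zero    = [] ∷ []
vecs xs (suc m) = cartesianProductWith _∷_ xs (vecs xs m)

length-vecs : ∀ (xs : List A) m → length (vecs xs m) ≡ length xs ^ m
length-vecs xs zero    = refl
length-vecs xs (suc m) =
  trans (length-cartesianProductWith _∷_ xs (vecs xs m)) (cong (length xs *_) (length-vecs xs m))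

∈-vecs : ∀ {xs : List A} → (∀ x → x ∈ xs) → ∀ {m} (v : Vec A m) → v ∈ vecs xs m
∈-vecs ∈xs []      = here refl
∈-vecs ∈xs (x ∷ v) = ∈-cartesianProductWith⁺ _∷_ (∈xs x) (∈-vecs ∈xs v)

-- Counted with multiplicity, every vector arises as `v [ i ]≔ x` from `length xs` pairs, because
-- the overwritten entry of `v` is arbitrary.
∑-vecs-update : ∀ (xs : List A) {m} (i : Fin m) f →
  ∑ (vecs xs m) (λ v → ∑ xs (λ x → f (v [ i ]≔ x))) ≡ length xs * ∑ (vecs xs m) f
∑-vecs-update xs {suc m} zero f = begin
  ∑ (vecs xs (suc m)) (λ v → ∑ xs (λ x → f (v [ zero ]≔ x)))
    ≡⟨ ∑-cartesianProductWith _∷_ xs (vecs xs m) _ ⟩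
  ∑ xs (λ _ → ∑ (vecs xs m) (λ v → ∑ xs (λ x → f (x ∷ v))))
    ≡⟨ ∑-const xs _ ⟩
  length xs * ∑ (vecs xs m) (λ v → ∑ xs (λ x → f (x ∷ v)))
    ≡⟨ cong (length xs *_) (∑-comm (vecs xs m) xs _) ⟩
  length xs * ∑ xs (λ x → ∑ (vecs xs m) (λ v → f (x ∷ v)))
    ≡⟨ cong (length xs *_) (∑-cartesianProductWith _∷_ xs (vecs xs m) f) ⟨
  length xs * ∑ (vecs xs (suc m)) f ∎
  where open ≡-Reasoning
∑-vecs-update xs {suc m} (suc i) f = begin
  ∑ (vecs xs (suc m)) (λ v → ∑ xs (λ x → f (v [ suc i ]≔ x)))
    ≡⟨ ∑-cartesianProductWith _∷_ xs (vecs xs m) _ ⟩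
  ∑ xs (λ y → ∑ (vecs xs m) (λ v → ∑ xs (λ x → f (y ∷ (v [ i ]≔ x)))))
    ≡⟨ ∑-cong xs (λ y → ∑-vecs-update xs i (f ∘ (y ∷_))) ⟩
  ∑ xs (λ y → length xs * ∑ (vecs xs m) (f ∘ (y ∷_)))
    ≡⟨ ∑-*ˡ (length xs) xs _ ⟩
  length xs * ∑ xs (λ y → ∑ (vecs xs m) (f ∘ (y ∷_)))
    ≡⟨ cong (length xs *_) (∑-cartesianProductWith _∷_ xs (vecs xs m) f) ⟨
  length xs * ∑ (vecs xs (suc m)) f ∎
  where open ≡-Reasoning

-- Running out of entries early still yields `[]`, so the subsequences have length at most `r`, not
-- exactly `r`.
sublists : ℕ → List A → List (List A)
sublists zero    xs       = [] ∷ []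
sublists (suc r) []       = [] ∷ []
sublists (suc r) (x ∷ xs) = sublists (suc r) xs ++ map (x ∷_) (sublists r xs)

length-sublists : ∀ r (xs : List A) → length (sublists r xs) ≤ suc (length xs) ^ r
length-sublists zero    xs       = ≤-refl
length-sublists (suc r) []       = m^n>0 1 (suc r)
length-sublists (suc r) (x ∷ xs) = begin
  length (sublists (suc r) xs ++ map (x ∷_) (sublists r xs))
    ≡⟨ length-++ (sublists (suc r) xs) ⟩
  length (sublists (suc r) xs) + length (map (x ∷_) (sublists r xs))
    ≡⟨ cong (length (sublists (suc r) xs) +_) (length-map (x ∷_) (sublists r xs)) ⟩
  length (sublists (suc r) xs) + length (sublists r xs)
    ≤⟨ +-mono-≤ (length-sublists (suc r) xs) (length-sublists r xs) ⟩
  s * s ^ r + s ^ r        ≡⟨ +-comm (s * s ^ r) (s ^ r) ⟩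
  suc s * s ^ r            ≤⟨ *-monoʳ-≤ (suc s) (^-monoˡ-≤ r (n≤1+n s)) ⟩
  suc s * suc s ^ r        ∎
  where
  open ≤-Reasoning
  s = suc (length xs)

All-length-sublists : ∀ r (xs : List A) → All (λ ys → length ys ≤ r) (sublists r xs)
All-length-sublists r xs = All.tabulate (bound r xs)
  where
  bound : ∀ r xs {ys} → ys ∈ sublists r xs → length ys ≤ r
  bound zero    xs       (here refl) = z≤n
  bound (suc r) []       (here refl) = z≤n
  bound (suc r) (x ∷ xs) ys∈ with ∈-++⁻ (sublists (suc r) xs) ys∈
  ... | inj₁ ys∈₁ = bound (suc r) xs ys∈₁
  ... | inj₂ ys∈₂ with zs , zs∈ , refl ← ∈-map⁻ (x ∷_) ys∈₂ = s≤s (bound r xs zs∈)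

-- Used to name the realised candidates: if there are at most `r` of them, they form one of the few
-- lists in `sublists r`.
filter∈sublists : ∀ (P? : Decidable P) r xs → length (filter P? xs) ≤ r → filter P? xs ∈ sublists r xs
filter∈sublists P? zero xs ≤r with [] ← filter P? xs = here refl
filter∈sublists P? (suc r) [] ≤r = here refl
filter∈sublists P? (suc r) (x ∷ xs) ≤r with does (P? x)
... | true  = ∈-++⁺ʳ (sublists (suc r) xs) (∈-map⁺ (x ∷_) (filter∈sublists P? r xs (s≤s⁻¹ ≤r)))
... | false = ∈-++⁺ˡ (filter∈sublists P? (suc r) xs ≤r)

-- Edges of K_N are added one at a time along the suffixes of `edges N`; this lists each possible
-- next edge with the edges added before it.
splits : List A → List (A × List A)
splits []       = []
splits (x ∷ xs) = (x , xs) ∷ splits xs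

length-splits : ∀ (xs : List A) → length (splits xs) ≡ length xs
length-splits []       = refl
length-splits (x ∷ xs) = cong suc (length-splits xs)

-- `P` holds at the empty suffix and fails at the whole list, so it must change between two
-- consecutive suffixes; the search starts at the long end.
first-failure : ∀ {P : Pred (List A) ℓ} → Decidable P → P [] → ∀ xs → Unique xs → ¬ P xs →
  ∃₂ λ x ys → (x , ys) ∈ splits xs × x ∉ ys × length ys < length xs × P ys × ¬ P (x ∷ ys)
first-failure P? P[] []       _          ¬P = ⊥-elim (¬P P[])
first-failure P? P[] (x ∷ xs) u@(_ ∷ u′) ¬P with P? xs
... | yes Pxs = x , xs , here refl , Unique.Unique[x∷xs]⇒x∉xs u , ≤-refl , Pxs , ¬P
... | no ¬Pxs with first-failure P? P[] xs u′ ¬Pxs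
...   | y , ys , ∈s , y∉ys , ys<xs , rest = y , ys , there ∈s , y∉ys , m≤n⇒m≤1+n ys<xs , rest

-- The edges of a complete graph, and averaging over maps.

firstEdge : ∀ {N} → Fin N → Edge (suc N)
firstEdge y = edge zero (suc y) z<s

sucEdge : ∀ {N} → Edge N → Edge (suc N)
sucEdge (edge i j i<j) = edge (suc i) (suc j) (s<s i<j)

edges : ∀ N → List (Edge N)
edges zero    = []
edges (suc N) = map firstEdge (allFin N) ++ map sucEdge (edges N)

∈-edges : ∀ {N} (e : Edge N) → e ∈ edges N
∈-edges {suc N} (edge zero    (suc j) _)   = ∈-++⁺ˡ (∈-map⁺ firstEdge (∈-allFin j))
∈-edges {suc N} (edge (suc i) (suc j) i<j) =
  ∈-++⁺ʳ (map firstEdge (allFin N)) (∈-map⁺ sucEdge (∈-edges (edge i j (s<s⁻¹ i<j))))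
∈-edges {suc N} (edge zero zero ())

edges-unique : ∀ N → Unique (edges N)
edges-unique zero    = []
edges-unique (suc N) = Unique.++⁺
  (Unique.map⁺ (λ { refl → refl }) (Unique.allFin⁺ N))
  (Unique.map⁺ (λ { refl → refl }) (edges-unique N))
  λ (e∈₁ , e∈₂) → disjoint (∈-map⁻ firstEdge e∈₁) (∈-map⁻ sucEdge e∈₂)
  where
  disjoint : ∀ {e} → ∃[ y ] y ∈ allFin N × e ≡ firstEdge y →
             ¬ (∃[ e′ ] e′ ∈ edges N × e ≡ sucEdge e′)
  disjoint (_ , _ , refl) (_ , _ , ())

length-edges : ∀ N → length (edges N) ≡ N C 2
length-edges zero    = refl
length-edges (suc N) = begin
  length (edges (suc N))
    ≡⟨ length-++ (map firstEdge (allFin N)) ⟩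
  length (map firstEdge (allFin N)) + length (map sucEdge (edges N))
    ≡⟨ cong₂ _+_ (length-map firstEdge (allFin N)) (length-map sucEdge (edges N)) ⟩
  length (allFin N) + length (edges N)  ≡⟨ cong₂ _+_ (length-allFin N) (length-edges N) ⟩
  N + N C 2                             ≡⟨ cong (_+ N C 2) (nC1≡n N) ⟨
  N C 1 + N C 2                         ≡⟨ nCk+nC[k+1]≡[n+1]C[k+1] N 1 ⟩
  suc N C 2                             ∎
  where open ≡-Reasoning

-- Summing over `v` after two coordinates have been resampled multiplies a sum by n^2, so the strict
-- inequality holds on average and hence for some `v`. Joining the two hypotheses in one inequality
-- secures both properties at the same `v`: a local `f`-sum above n^2 / 2a and a local `g`-sum that
-- is small against it.
∑-average : ∀ {A : Set} (xs : List A) {m} (i j : Fin m) (f g : Vec A m → ℕ) a b →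
  0 < length xs → b * ∑ (vecs xs m) g < length xs ^ m → length xs ^ m ≤ a * ∑ (vecs xs m) f →
  ∃[ v ] b * ∑ xs (λ x → ∑ xs (λ y → g (v [ i ]≔ x [ j ]≔ y))) + length xs * length xs
         < 2 * a * ∑ xs (λ x → ∑ xs (λ y → f (v [ i ]≔ x [ j ]≔ y)))
∑-average xs {m} i j f g a b n>0 g-small f-large = proj₁ found , proj₂ (proj₂ found)
  where
  open ≤-Reasoning
  n = length xs
  double : (Vec _ m → ℕ) → Vec _ m → ℕ
  double h v = ∑ xs (λ x → ∑ xs (λ y → h (v [ i ]≔ x [ j ]≔ y)))
  ∑-double : ∀ h → ∑ (vecs xs m) (double h) ≡ n * (n * ∑ (vecs xs m) h)
  ∑-double h = trans (∑-vecs-update xs i (λ v → ∑ xs (λ y → h (v [ j ]≔ y))))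
                     (cong (n *_) (∑-vecs-update xs j h))
  rearrange₁ : ∀ b n s t → b * (n * (n * s)) + t * (n * n) ≡ n * n * (b * s + t)
  rearrange₁ = solve-∀
  rearrange₂ : ∀ a n s → n * n * (a * s + a * s) ≡ 2 * a * (n * (n * s))
  rearrange₂ = solve-∀
  instance
    n*n≢0 : NonZero (n * n)
    n*n≢0 = >-nonZero (*-mono-≤ n>0 n>0)
  found = ∑-<⇒∃ (vecs xs m) (λ v → b * double g v + n * n) (λ v → 2 * a * double f v) (begin-strict
    ∑ (vecs xs m) (λ v → b * double g v + n * n)
      ≡⟨ ∑-+ (vecs xs m) _ _ ⟩
    ∑ (vecs xs m) (λ v → b * double g v) + ∑ (vecs xs m) (const (n * n))
      ≡⟨ cong₂ _+_ (∑-*ˡ b (vecs xs m) (double g)) (∑-const (vecs xs m) (n * n)) ⟩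
    b * ∑ (vecs xs m) (double g) + length (vecs xs m) * (n * n)
      ≡⟨ cong₂ (λ s t → b * s + t * (n * n)) (∑-double g) (length-vecs xs m) ⟩
    b * (n * (n * ∑ (vecs xs m) g)) + n ^ m * (n * n)
      ≡⟨ rearrange₁ b n (∑ (vecs xs m) g) (n ^ m) ⟩
    n * n * (b * ∑ (vecs xs m) g + n ^ m)
      <⟨ *-monoʳ-< (n * n) (+-mono-<-≤ (<-≤-trans g-small f-large) f-large) ⟩
    n * n * (a * ∑ (vecs xs m) f + a * ∑ (vecs xs m) f)
      ≡⟨ rearrange₂ a n (∑ (vecs xs m) f) ⟩
    2 * a * (n * (n * ∑ (vecs xs m) f))
      ≡⟨ cong (2 * a *_) (∑-double f) ⟨
    2 * a * ∑ (vecs xs m) (double f)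
      ≡⟨ ∑-*ˡ (2 * a) (vecs xs m) (double f) ⟨
    ∑ (vecs xs m) (λ v → 2 * a * double f v) ∎)

-- The entries kept are those outside `P` and some of those in `Q`; the count of `P` is moved to the
-- left to avoid subtraction.
length-filter-⊎ : ∀ {A : Set} {P Q : Pred A 0ℓ} (P? : Decidable P) (Q? : Decidable Q) xs →
  length (filter (λ x → ¬? (P? x) ⊎-dec Q? x) xs) + length (filter P? xs) ≤ length xs + length (filter Q? xs)
length-filter-⊎ P? Q? []       = z≤n
length-filter-⊎ P? Q? (x ∷ xs) with ih ← length-filter-⊎ P? Q? xs | does (P? x) | does (Q? x)
... | true  | true  = s≤s (subst₂ _≤_ (sym (+-suc _ _)) (sym (+-suc _ _)) (s≤s ih))
... | true  | false = ≤-trans (≤-reflexive (+-suc _ _)) (s≤s ih)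
... | false | true  = s≤s (≤-trans ih (+-monoʳ-≤ (length xs) (n≤1+n _)))
... | false | false = s≤s ih

StrictlyMonotone : ∀ {m n} → (Fin m → Fin n) → Set
StrictlyMonotone φ = ∀ {i j} → i Fin.< j → φ i Fin.< φ j

-- Templates as point lists, partly realised copies and candidates.

module Core {k N n : ℕ} (d₀ : Fin k) (F : List (Colouring k N)) where

  -- A colouring is a matrix of which only the entries above the diagonal count,
  -- and a template is a list of points ((x , y) , d) with d allowed on xy.

  Matrix : Set
  Matrix = Fin n → Fin n → Fin k

  Point : Set
  Point = (Fin n × Fin n) × Fin k

  _≟ᵖ_ : DecidableEquality Point
  _≟ᵖ_ = ≡-dec (≡-dec Fin._≟_ Fin._≟_) Fin._≟_

  open DecMembership _≟ᵖ_ using (_∈?_)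

  maps : List (Vec (Fin n) N)
  maps = vecs (allFin n) N

  ends : Vec (Fin n) N → Edge N → Fin n × Fin n
  ends φ e = lookup φ (Edge.i e) , lookup φ (Edge.j e)

  -- Point lists also have entries on and below the diagonal. The order condition on all edges
  -- forces `φ` to be increasing, so that copies correspond to N-sets.
  Copy : List Point → Vec (Fin n) N → Colouring k N → Set
  Copy t φ f = All (λ e → lookup φ (Edge.i e) Fin.< lookup φ (Edge.j e) × (ends φ e , f e) ∈ t) (edges N)

  Agrees : Matrix → List (Edge N) → Vec (Fin n) N → Colouring k N → Set
  Agrees c es φ f = All (λ e → uncurry c (ends φ e) ≡ f e) es

  Copy? : ∀ t φ f → Dec (Copy t φ f)
  Copy? t φ f = All.all?
    (λ e → (lookup φ (Edge.i e) Fin.<? lookup φ (Edge.j e)) ×-dec ((ends φ e , f e) ∈? t)) (edges N)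

  Agrees? : ∀ c es φ f → Dec (Agrees c es φ f)
  Agrees? c es φ f = All.all? (λ e → uncurry c (ends φ e) Fin.≟ f e) es

  -- The maps counted by X(`es`); one and the same `f` has to fit into `t` and to agree with `c` on
  -- `es`.
  PartlyRealised : List Point → Matrix → List (Edge N) → Pred (Vec (Fin n) N) 0ℓ
  PartlyRealised t c es φ = Any (λ f → Copy t φ f × Agrees c es φ f) F

  partlyRealised? : ∀ t c es → Decidable (PartlyRealised t c es)
  partlyRealised? t c es φ = Any.any? (λ f → Copy? t φ f ×-dec Agrees? c es φ f) F

  HasCopy : List Point → Pred (Vec (Fin n) N) 0ℓ
  HasCopy t φ = Any (Copy t φ) F

  hasCopy? : ∀ t → Decidable (HasCopy t)
  hasCopy? t φ = Any.any? (Copy? t φ) F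

  Increasing : Vec (Fin n) N → Set
  Increasing φ = StrictlyMonotone (lookup φ)

  Free : Pred Matrix 0ℓ
  Free c = ∀ φ → Increasing φ → ¬ Any (λ f → ∀ e → uncurry c (ends φ e) ≡ f e) F

  infix 4 _∈ᵗ_

  _∈ᵗ_ : Matrix → List Point → Set
  c ∈ᵗ t = ∀ x y → x Fin.< y → ((x , y) , c x y) ∈ t

  -- This is X(E(K_N)) = 0: a copy is increasing by definition, and agreement on all edges would
  -- make it a forbidden restriction of `c`.
  free⇒¬realised : ∀ {t c} → Free c → ∀ φ → ¬ PartlyRealised t c (edges N) φ
  free⇒¬realised {t} {c} free φ pr = free φ increasing (Any.map (λ (_ , ag) e → All.lookup ag (∈-edges e)) pr)
    where
    increasing : Increasing φ
    increasing {i} {j} i<j with f , _ , copy , _ ← find pr =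
      proj₁ (All.lookup copy (∈-edges (edge i j i<j)))

  Compatible : Matrix → Matrix → ∀ {m} → Vec (Fin n) m → Set
  Compatible c c′ φ = ∀ l y → c′ (lookup φ l) y ≡ c (lookup φ l) y × c′ y (lookup φ l) ≡ c y (lookup φ l)

  rows : List (Vec (Fin k) n)
  rows = vecs (allFin k) n

  insertStar : Fin n → Vec (Fin k) n × Vec (Fin k) n → Matrix → Matrix
  insertStar u (r , s) c x y =
    if does (x Fin.≟ u) then lookup r y else if does (y Fin.≟ u) then lookup s x else c x y

  -- All ways to fill in the stars at the entries of `φ`, a row and a column for each; the rest
  -- stays at the default `d₀`. Each entry of `φ` thus costs 2n symbols.
  guesses : ∀ {m} → Vec (Fin n) m → List Matrix
  guesses []      = (λ _ _ → d₀) ∷ []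
  guesses (u ∷ φ) = cartesianProductWith (insertStar u) (cartesianProduct rows rows) (guesses φ)

  length-guesses : ∀ {m} (φ : Vec (Fin n) m) → length (guesses φ) ≡ (k ^ n * k ^ n) ^ m
  length-guesses []      = refl
  length-guesses (u ∷ φ) = trans (length-cartesianProductWith _ (cartesianProduct rows rows) (guesses φ))
    (cong₂ _*_ (trans (length-cartesianProductWith _ rows rows) (cong₂ _*_ length-rows length-rows))
               (length-guesses φ))
    where
    length-rows : length rows ≡ k ^ n
    length-rows = trans (length-vecs (allFin k) n) (cong (_^ n) (length-allFin k))

  -- The star at `u` is filled in with the true entries of `c`, so it cannot spoil an earlier star,
  -- even where the two overlap or `u` is repeated.
  guesses-complete : ∀ c {m} (φ : Vec (Fin n) m) → Any (λ c′ → Compatible c c′ φ) (guesses φ)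
  guesses-complete c []      = here λ ()
  guesses-complete c (u ∷ φ) with c′ , c′∈ , compat ← find (guesses-complete c φ) =
    lose (∈-cartesianProductWith⁺ (insertStar u) r,s∈ c′∈) compat′
    where
    r s : Vec (Fin k) n
    r = Vec.tabulate (c u)
    s = Vec.tabulate (λ x → c x u)
    r,s∈ : (r , s) ∈ cartesianProduct rows rows
    r,s∈ = ∈-cartesianProduct⁺ (∈-vecs ∈-allFin r) (∈-vecs ∈-allFin s)
    c″ = insertStar u (r , s) c′
    row : ∀ {w} y → w ≡ u → c″ w y ≡ c w y
    row y refl with u Fin.≟ u
    ... | yes _  = lookup∘tabulate (c u) y
    ... | no u≢u = ⊥-elim (u≢u refl)
    column : ∀ {w} x → w ≡ u → c″ x w ≡ c x w
    column x refl with x Fin.≟ u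
    -- The diagonal entry is read from the row, which carries the right value `c u u` too.
    ... | yes refl = lookup∘tabulate (c u) u
    ... | no _ with u Fin.≟ u
    ...   | yes _  = lookup∘tabulate (λ x → c x u) x
    ...   | no u≢u = ⊥-elim (u≢u refl)
    elsewhere : ∀ x y → c′ x y ≡ c x y → c″ x y ≡ c x y
    elsewhere x y eq with x Fin.≟ u | y Fin.≟ u
    ... | yes refl | _        = lookup∘tabulate (c u) y
    ... | no _     | yes refl = lookup∘tabulate (λ x → c x u) x
    ... | no _     | no _     = eq
    compat′ : Compatible c c″ (u ∷ φ)
    compat′ zero    y = row y refl , column y refl
    compat′ (suc l) y = elsewhere _ y (proj₁ (compat l y)) , elsewhere y _ (proj₂ (compat l y))

  move : Vec (Fin n) N → Edge N → Fin n × Fin n → Vec (Fin n) N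
  move φ e (x , y) = φ [ Edge.i e ]≔ x [ Edge.j e ]≔ y

  i≢j : (e : Edge N) → Edge.i e ≢ Edge.j e
  i≢j (edge i j i<j) refl = ⊥-elim-irr (Fin.<-irrefl refl i<j)

  ends-move : ∀ φ e p → ends (move φ e p) e ≡ p
  ends-move φ e (x , y) = cong₂ _,_
    (trans (lookup∘update′ (i≢j e) (φ [ Edge.i e ]≔ x) y) (lookup∘update (Edge.i e) φ x))
    (lookup∘update (Edge.j e) (φ [ Edge.i e ]≔ x) y)

  -- An edge other than e has an endpoint that does not move, and c′ is
  -- correct on all edges at that endpoint.
  compatible⇒≡ : ∀ {c c′} φ → Compatible c c′ φ → ∀ e e′ p → e′ ≢ e →
                 uncurry c′ (ends (move φ e p) e′) ≡ uncurry c (ends (move φ e p) e′)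
  compatible⇒≡ {c} {c′} φ compat e@(edge i j i<j) e′@(edge a b a<b) (x , y) e′≢e
    with a Fin.≟ i | a Fin.≟ j
  ... | no a≢i | no a≢j rewrite lookup∘update′ a≢j (φ [ i ]≔ x) y
                              | lookup∘update′ a≢i φ x = proj₁ (compat a _)
  ... | yes refl | _ rewrite lookup∘update′ {i = b} {j} (λ { refl → e′≢e refl }) (φ [ i ]≔ x) y
                           | lookup∘update′ (i≢j e′ ∘ sym) φ x = proj₂ (compat b _)
  ... | no _ | yes refl rewrite lookup∘update′ (i≢j e′ ∘ sym) (φ [ i ]≔ x) y
                              | lookup∘update′ {i = b} {i} (λ { refl → ⊥-elim-irr (Fin.<-asym a<b i<j) }) φ x
                        = proj₂ (compat b _)

  pairs : List (Fin n × Fin n)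
  pairs = cartesianProduct (allFin n) (allFin n)

  ∑-pairs : ∀ {P : Pred (Fin n × Fin n) 0ℓ} (P? : Decidable P) →
            length (filter P? pairs) ≡ ∑ (allFin n) (λ x → ∑ (allFin n) (λ y → 𝟙 (P? (x , y))))
  ∑-pairs P? =
    trans (length-filter≡∑ P? pairs) (∑-cartesianProductWith _,_ (allFin n) (allFin n) (𝟙 ∘ P?))

  length-pairs : length pairs ≡ n * n
  length-pairs = trans (length-cartesianProductWith _,_ (allFin n) (allFin n))
                       (cong₂ _*_ (length-allFin n) (length-allFin n))

  pairs-unique : Unique pairs
  pairs-unique = Unique.cartesianProduct⁺ (Unique.allFin⁺ n) (Unique.allFin⁺ n)

  -- The points that complete a copy when the ends of e move and c′ realises the
  -- edges in es.  This depends on c′ only through its stars at φ.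
  Candidate : List Point → Matrix → Edge N → List (Edge N) → Vec (Fin n) N → Pred Point 0ℓ
  Candidate t c′ e es φ (p , d) =
    Any (λ f → f e ≡ d × Copy t (move φ e p) f × Agrees c′ es (move φ e p) f) F

  candidate? : ∀ t c′ e es φ → Decidable (Candidate t c′ e es φ)
  candidate? t c′ e es φ (p , d) =
    Any.any? (λ f → (f e Fin.≟ d) ×-dec Copy? t (move φ e p) f ×-dec Agrees? c′ es (move φ e p) f) F

  candidates : List Point → Matrix → Edge N → List (Edge N) → Vec (Fin n) N → List Point
  candidates t c′ e es φ = filter (candidate? t c′ e es φ) t

  realised? : ∀ c → Decidable {A = Point} (λ v → uncurry c (proj₁ v) ≡ proj₂ v)
  realised? c v = uncurry c (proj₁ v) Fin.≟ proj₂ v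

  -- Here `s` is a guess of the candidates that the colouring realises; all other candidates leave
  -- the template.
  thin : List Point → Matrix → Edge N → List (Edge N) → Vec (Fin n) N → List Point → List Point
  thin t c′ e es φ s = filter (λ v → ¬? (candidate? t c′ e es φ v) ⊎-dec (v ∈? s)) t

  localCount : List Point → Edge N → Vec (Fin n) N → Matrix → List (Edge N) → ℕ
  localCount t e φ c es =
    ∑ (allFin n) (λ x → ∑ (allFin n) (λ y → 𝟙 (partlyRealised? t c es (move φ e (x , y)))))

  module _ (t : List Point) (c′ : Matrix) (e : Edge N) (es : List (Edge N)) (φ : Vec (Fin n) N) where

    private
      cands = candidates t c′ e es φ

    length-thin : Unique t → ∀ s → length (thin t c′ e es φ s) + length cands ≤ length t + length s
    length-thin t! s = ≤-trans (length-filter-⊎ (candidate? t c′ e es φ) (_∈? s) t)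
      (+-monoʳ-≤ (length t)
        (Unique-⊆⇒length-≤ (Unique.filter⁺ (_∈? s) t!) (proj₂ ∘ ∈-filter⁻ (_∈? s) {xs = t})))

    -- With the correct list of realised candidates, a point that leaves is not realised by `c`, so
    -- `c` survives.
    ∈ᵗ-thin : ∀ c → c ∈ᵗ t → c ∈ᵗ thin t c′ e es φ (filter (realised? c) cands)
    ∈ᵗ-thin c c∈t x y x<y = ∈-filter⁺ _ (c∈t x y x<y) kept
      where
      v = (x , y) , c x y
      kept : ¬ Candidate t c′ e es φ v ⊎ v ∈ filter (realised? c) cands
      kept with candidate? t c′ e es φ v
      ... | no ¬cand = inj₁ ¬cand
      ... | yes cand =
        inj₂ (∈-filter⁺ (realised? c) (∈-filter⁺ (candidate? t c′ e es φ) (c∈t x y x<y) cand) refl)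

    module _ (c : Matrix) (compat : Compatible c c′ φ) (e∉es : e ∉ es) where

      private
        agree : ∀ {e′} p → e′ ∈ es →
                uncurry c′ (ends (move φ e p) e′) ≡ uncurry c (ends (move φ e p) e′)
        agree {e′} p e′∈es = compatible⇒≡ {c} {c′} φ compat e e′ p (λ { refl → e∉es e′∈es })

        Q? : ∀ es′ → Decidable (λ p → PartlyRealised t c es′ (move φ e p))
        Q? es′ p = partlyRealised? t c es′ (move φ e p)

        good : List (Edge N) → List (Fin n × Fin n)
        good es′ = filter (Q? es′) pairs

      -- A position `p` that is counted carries a copy using the point `(p , f e)`. As `e` is not in
      -- `es`, the guess `c′` agrees with `c` on the edges to be tested, so this point is a
      -- candidate, and it determines `p`.
      many-candidates : localCount t e φ c es ≤ length cands
      many-candidates = begin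
        localCount t e φ c es    ≡⟨ ∑-pairs (Q? es) ⟨
        length (good es)         ≤⟨ Unique-⊆⇒length-≤ (Unique.filter⁺ (Q? es) pairs-unique) good⊆ ⟩
        length (map proj₁ cands) ≡⟨ length-map proj₁ cands ⟩
        length cands             ∎
        where
        open ≤-Reasoning
        good⊆ : ∀ {p} → p ∈ good es → p ∈ map proj₁ cands
        good⊆ {p} p∈ with f , f∈F , copy , ag ← find (proj₂ (∈-filter⁻ (Q? es) {xs = pairs} p∈)) =
          ∈-map⁺ proj₁ (∈-filter⁺ (candidate? t c′ e es φ) point∈t
            (lose f∈F (refl , copy , All.tabulate λ e′∈es → trans (agree p e′∈es) (All.lookup ag e′∈es))))
          where
          point∈t : (p , f e) ∈ t
          point∈t = subst (λ p → (p , f e) ∈ t) (ends-move φ e p) (proj₂ (All.lookup copy (∈-edges e)))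

      -- The colour of a realised candidate is determined by its position, and realising it means
      -- that the copy agrees with `c` on `e` as well as on `es`.
      few-realised : Unique t → length (filter (realised? c) cands) ≤ localCount t e φ c (e ∷ es)
      few-realised t! = begin
        length (filter (realised? c) cands)  ≤⟨ Unique-⊆⇒length-≤ realised! realised⊆ ⟩
        length (map graph (good (e ∷ es)))   ≡⟨ length-map graph (good (e ∷ es)) ⟩
        length (good (e ∷ es))               ≡⟨ ∑-pairs (Q? (e ∷ es)) ⟩
        localCount t e φ c (e ∷ es)          ∎
        where
        open ≤-Reasoning
        realised! : Unique (filter (realised? c) cands)
        realised! = Unique.filter⁺ (realised? c) (Unique.filter⁺ (candidate? t c′ e es φ) t!)
        graph : Fin n × Fin n → Point
        graph p = p , uncurry c p
        realised⊆ : ∀ {v} → v ∈ filter (realised? c) cands → v ∈ map graph (good (e ∷ es))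
        realised⊆ {p , d} v∈
          with v∈cands , refl ← ∈-filter⁻ (realised? c) {xs = cands} v∈
          with f , f∈F , fe≡d , copy , ag ←
                 find (proj₂ (∈-filter⁻ (candidate? t c′ e es φ) {xs = t} v∈cands)) =
          ∈-map⁺ graph (∈-filter⁺ (Q? (e ∷ es)) (∈-cartesianProduct⁺ (∈-allFin _) (∈-allFin _))
            (lose f∈F (copy , trans (cong (uncurry c) (ends-move φ e p)) (sym fe≡d)
                              ∷ All.tabulate λ e′∈es → trans (sym (agree p e′∈es)) (All.lookup ag e′∈es))))

-- The branching process and its cost in symbols.

n<k^n : ∀ {k} → 2 ≤ k → ∀ n → n < k ^ n
n<k^n         2≤k zero    = z<s
n<k^n {k} 2≤k (suc n) = begin-strict
  suc n          <⟨ s<s (n<k^n 2≤k n) ⟩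
  suc (k ^ n)    ≤⟨ +-monoˡ-≤ (k ^ n) (m^n>0 k n) ⟩
  k ^ n + k ^ n  ≡⟨ cong (k ^ n +_) (+-identityʳ (k ^ n)) ⟨
  2 * k ^ n      ≤⟨ *-monoˡ-≤ (k ^ n) 2≤k ⟩
  k * k ^ n      ∎
  where
  open ≤-Reasoning
  instance
    k≢0 : NonZero k
    k≢0 = >-nonZero (≤-trans z<s 2≤k)

+-/-≤ : ∀ {q} .{{_ : NonZero q}} a x y → a * q + x ≤ y → a + x / q ≤ y / q
+-/-≤ {q} a x y le = begin
  a + x / q            ≡⟨ cong (_+ x / q) (m*n/n≡m a q) ⟨
  a * q / q + x / q    ≡⟨ +-distrib-/-∣ˡ x (divides-refl a) ⟨
  (a * q + x) / q      ≤⟨ /-monoˡ-≤ q le ⟩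
  y / q                ∎
  where open ≤-Reasoning

module Build {k N n : ℕ} (d₀ : Fin k) (F : List (Colouring k N)) (E q D : ℕ)
  (2≤k : 2 ≤ k) (0<n : 0 < n) (0<E : 0 < E) (2≤q : 2 ≤ q)
  -- This holds for `q` up to the (2b-1)-th root of n, as j ≤ b - 1. The condition after it says
  -- that a point can be named with D q symbols.
  (power≤n : ∀ {j} → j < length (edges N) → q ^ (suc (2 * j)) ≤ n)
  (n*n*k<k^Dq : n * n * k < k ^ (D * q)) where

  open Core {n = n} d₀ F

  private instance
    k≢0 : NonZero k
    k≢0 = >-nonZero (≤-trans z<s 2≤k)
    q≢0 : NonZero q
    q≢0 = >-nonZero (≤-trans z<s 2≤q)
    n≢0 : NonZero n
    n≢0 = >-nonZero 0<n
    E≢0 : NonZero E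
    E≢0 = >-nonZero 0<E
    q*q≢0 : NonZero (q * q)
    q*q≢0 = m*n≢0 q q

  Sparse : Pred (List Point) 0ℓ
  Sparse t = E * length (filter (hasCopy? t) maps) < n ^ N

  Containers : Pred Matrix 0ℓ → ℕ → Set
  Containers G m = ∃[ T ] (∀ c → G c → Any (c ∈ᵗ_) T) × All Sparse T × length T ≤ m

  weaken : ∀ {G H : Pred Matrix 0ℓ} {m m′} → (∀ c → H c → G c) → m ≤ m′ →
           Containers G m → Containers H m′
  weaken H⊆G m≤m′ (T , covers , sparse , small) =
    T , (λ c → covers c ∘ H⊆G c) , sparse , ≤-trans small m≤m′

  branch : ∀ {B : Set} {m} (G : B → Pred Matrix 0ℓ) {bs} → All (λ b → Containers (G b) m) bs →
           Containers (λ c → Any (λ b → G b c) bs) (length bs * m)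
  branch G []             = [] , (λ _ ()) , [] , z≤n
  branch G ((T , covers , sparse , small) ∷ cs) with branch G cs
  ... | T′ , covers′ , sparse′ , small′ =
    T ++ T′
    , (λ { c (here Gbc)  → Any.++⁺ˡ (covers c Gbc)
         ; c (there Gbc) → Any.++⁺ʳ T (covers′ c Gbc) })
    , ++⁺ sparse sparse′
    , ≤-trans (≤-reflexive (length-++ T)) (+-mono-≤ small small′)

  -- A removed point may cost O(1/q) symbols: `many` makes the removed points pay for the O(n)
  -- symbols of the stars, `few` for listing the realised ones at O(q) symbols each.
  record Informative (t : List Point) (e : Edge N) (es : List (Edge N)) (φ : Vec (Fin n) N)
                     (c′ c : Matrix) : Set where
    private
      cands = candidates t c′ e es φ
    field
      c∈t  : c ∈ᵗ t
      free : Free c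
      many : n * q ≤ 2 * E * length cands
      few  : length (filter (realised? c) cands) ≤ 2 * length cands / (q * q)

  -- Here w = q^(2|es|). Dropping n^2 and cancelling E w gives the second bound; keeping only n^2 on
  -- the left, using q w ≤ n and cancelling w gives the first. The exponent 2b - 1 originates in q w
  -- ≤ n, where |es| can be b - 1.
  informative-bounds : ∀ {w P R p r} .{{_ : NonZero w}} →
    E * (q * (q * w)) * R + n * n < 2 * (E * w) * P → r ≤ R → P ≤ p → q * w ≤ n →
    n * q ≤ 2 * E * p × r ≤ 2 * p / (q * q)
  informative-bounds {w} {P} {R} {p} {r} average r≤R P≤p qw≤n = many , few
    where
    open ≤-Reasoning
    rearrange₁ : ∀ r q E w → r * (q * q) * (E * w) ≡ E * (q * (q * w)) * r
    rearrange₁ = solve-∀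
    rearrange₂ : ∀ E w p → 2 * (E * w) * p ≡ 2 * p * (E * w)
    rearrange₂ = solve-∀
    rearrange₃ : ∀ E w p → 2 * (E * w) * p ≡ 2 * E * p * w
    rearrange₃ = solve-∀
    instance
      Ew≢0 : NonZero (E * w)
      Ew≢0 = m*n≢0 E w
    key : r * (q * q) * (E * w) + n * n ≤ 2 * (E * w) * p
    key = begin
      r * (q * q) * (E * w) + n * n    ≡⟨ cong (_+ n * n) (rearrange₁ r q E w) ⟩
      E * (q * (q * w)) * r + n * n    ≤⟨ +-monoˡ-≤ (n * n) (*-monoʳ-≤ (E * (q * (q * w))) r≤R) ⟩
      E * (q * (q * w)) * R + n * n    <⟨ average ⟩
      2 * (E * w) * P                  ≤⟨ *-monoʳ-≤ (2 * (E * w)) P≤p ⟩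
      2 * (E * w) * p                  ∎
    many : n * q ≤ 2 * E * p
    many = *-cancelʳ-≤ (n * q) (2 * E * p) w (begin
      n * q * w          ≡⟨ *-assoc n q w ⟩
      n * (q * w)        ≤⟨ *-monoʳ-≤ n qw≤n ⟩
      n * n              ≤⟨ m+n≤o⇒n≤o _ key ⟩
      2 * (E * w) * p    ≡⟨ rearrange₃ E w p ⟩
      2 * E * p * w      ∎)
    few : r ≤ 2 * p / (q * q)
    few = ≤-trans (≤-reflexive (sym (m*n/n≡m r (q * q)))) (/-monoˡ-≤ (q * q)
      (*-cancelʳ-≤ (r * (q * q)) (2 * p) (E * w) (begin
        r * (q * q) * (E * w)    ≤⟨ m+n≤o⇒m≤o _ key ⟩
        2 * (E * w) * p          ≡⟨ rearrange₂ E w p ⟩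
        2 * p * (E * w)          ∎)))

  module _ (t : List Point) (c : Matrix) where

    realisedCount : List (Edge N) → ℕ
    realisedCount es = ∑ maps (𝟙 ∘ partlyRealised? t c es)

    -- The bound X(es) ≥ n^N / (E q^(2|es|)) with its denominator cleared.
    Many : Pred (List (Edge N)) 0ℓ
    Many es = n ^ N ≤ E * q ^ (2 * length es) * realisedCount es

    many? : Decidable Many
    many? es = n ^ N ≤? E * q ^ (2 * length es) * realisedCount es

    many-[] : ¬ Sparse t → Many []
    many-[] dense = begin
      n ^ N
        ≤⟨ ≮⇒≥ dense ⟩
      E * length (filter (hasCopy? t) maps)
        ≡⟨ cong₂ (λ a xs → a * length xs) (sym (*-identityʳ E)) hasCopy≡ ⟩
      E * 1 * length (filter (partlyRealised? t c []) maps)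
        ≡⟨ cong (E * 1 *_) (length-filter≡∑ (partlyRealised? t c []) maps) ⟩
      E * 1 * realisedCount [] ∎
      where
      open ≤-Reasoning
      hasCopy≡ : filter (hasCopy? t) maps ≡ filter (partlyRealised? t c []) maps
      hasCopy≡ = filter-≐ (hasCopy? t) (partlyRealised? t c []) (Any.map (_, []) , Any.map proj₁) maps

    ¬many-edges : Free c → ¬ Many (edges N)
    ¬many-edges free many = <⇒≱ (m^n>0 n N) (begin
      n ^ N                          ≤⟨ many ⟩
      a * realisedCount (edges N)    ≡⟨ cong (a *_) (length-filter≡∑ realised∀? maps) ⟨
      a * length (filter realised∀? maps)
        ≡⟨ cong (λ xs → a * length xs) (filter-none realised∀? (All.universal (free⇒¬realised {t} {c} free) maps)) ⟩
      a * 0                          ≡⟨ *-zeroʳ a ⟩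
      0                              ∎)
      where
      open ≤-Reasoning
      a = E * q ^ (2 * length (edges N))
      realised∀? = partlyRealised? t c (edges N)

    Average : Edge N → List (Edge N) → Pred (Vec (Fin n) N) 0ℓ
    Average e es φ = E * (q * (q * w)) * localCount t e φ c (e ∷ es) + n * n
                   < 2 * (E * w) * localCount t e φ c es
      where w = q ^ (2 * length es)

    average : ∀ e es → Many es → ¬ Many (e ∷ es) → ∃[ φ ] Average e es φ
    average e es many ¬many = subst
      (λ l → 0 < l → b * ∑ maps g < l ^ N → l ^ N ≤ a * ∑ maps f →
             ∃[ φ ] b * localCount t e φ c (e ∷ es) + l * l < 2 * a * localCount t e φ c es)
      (length-allFin n)
      (∑-average (allFin n) (Edge.i e) (Edge.j e) f g a b)
      0<n
      -- Written as 2 + 2|es|, the exponent unfolds to the two factors q in `b`.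
      (subst (λ x → E * q ^ x * ∑ maps g < n ^ N) (*-suc 2 (length es)) (≰⇒> ¬many))
      many
      where
      f g : Vec (Fin n) N → ℕ
      f φ = 𝟙 (partlyRealised? t c es φ)
      g φ = 𝟙 (partlyRealised? t c (e ∷ es) φ)
      a b : ℕ
      a = E * q ^ (2 * length es)
      b = E * (q * (q * q ^ (2 * length es)))

    informative-at : ∀ e es φ → e ∉ es → q * q ^ (2 * length es) ≤ n → Unique t → c ∈ᵗ t → Free c →
                     Average e es φ → Any (λ c′ → Informative t e es φ c′ c) (guesses φ)
    informative-at e es φ e∉es power t! c∈t free avg = Any.map inform (guesses-complete c φ)
      where
      w = q ^ (2 * length es)
      inform : ∀ {c′} → Compatible c c′ φ → Informative t e es φ c′ c
      inform {c′} compat = record { c∈t = c∈t ; free = free ; many = proj₁ bounds ; few = proj₂ bounds }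
        where
        cands = candidates t c′ e es φ
        bounds : n * q ≤ 2 * E * length cands
               × length (filter (realised? c) cands) ≤ 2 * length cands / (q * q)
        bounds = informative-bounds
          {w} {localCount t e φ c es} {localCount t e φ c (e ∷ es)}
          {{m^n≢0 q (2 * length es)}} avg
          (few-realised t c′ e es φ c compat e∉es t!) (many-candidates t c′ e es φ c compat e∉es) power

    SomeInformative : Set
    SomeInformative =
      Any (λ (e , es) → Any (λ φ → Any (λ c′ → Informative t e es φ c′ c) (guesses φ)) maps) (splits (edges N))

    -- This makes the branching exhaustive: every free colouring in a dense template is caught by
    -- some guess of `e`, `es`, `φ` and `c′`.
    informative : Unique t → ¬ Sparse t → c ∈ᵗ t → Free c → SomeInformative
    informative t! dense c∈t free =
      from-failure (first-failure many? (many-[] dense) (edges N) (edges-unique N) (¬many-edges free))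
      where
      from-failure : (∃₂ λ e es → (e , es) ∈ splits (edges N) × e ∉ es × length es < length (edges N)
                                × Many es × ¬ Many (e ∷ es)) → SomeInformative
      from-failure (e , es , split∈ , e∉es , es<edges , many , ¬many) = from-average (average e es many ¬many)
        where
        from-average : ∃[ φ ] Average e es φ → SomeInformative
        from-average (φ , avg) =
          lose split∈ (lose (∈-vecs ∈-allFin φ) (informative-at e es φ e∉es (power≤n es<edges) t! c∈t free avg))

  -- Price of a removed point, times q. With s = b + 3N and p candidates, a step costs at most 2 (E
  -- s + D) p / q symbols and removes at least p / 2 points, whence the factor 4.
  rate : ℕ
  rate = 4 * (E * (length (edges N) + 3 * N) + D)

  budget : ℕ → ℕ
  budget l = rate * l / q

  -- Crude cost of a guess: at most b ≤ b n symbols for the edge, n for each entry of `φ` and 2n for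
  -- the star there.
  choices : ℕ
  choices = (length (edges N) + 3 * N) * n

  choices-bound : length (edges N) * (n ^ N * (k ^ n * k ^ n) ^ N) ≤ k ^ choices
  choices-bound = begin
    b * (n ^ N * (k ^ n * k ^ n) ^ N)
      ≤⟨ *-mono-≤ (<⇒≤ (n<k^n 2≤k b)) (*-monoˡ-≤ _ (^-monoˡ-≤ N (<⇒≤ (n<k^n 2≤k n)))) ⟩
    k ^ b * ((k ^ n) ^ N * (k ^ n * k ^ n) ^ N)
      ≡⟨ cong₂ (λ x y → k ^ b * (x * y)) (^-*-assoc k n N)
           (trans (cong (_^ N) (sym (^-distribˡ-+-* k n n))) (^-*-assoc k (n + n) N)) ⟩
    k ^ b * (k ^ (n * N) * k ^ ((n + n) * N))
      ≡⟨ cong (k ^ b *_) (^-distribˡ-+-* k (n * N) ((n + n) * N)) ⟨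
    k ^ b * k ^ (n * N + (n + n) * N)
      ≡⟨ ^-distribˡ-+-* k b _ ⟨
    k ^ (b + (n * N + (n + n) * N))
      ≤⟨ ^-monoʳ-≤ k (+-mono-≤ (m≤m*n b n) (≤-reflexive (rearrange n N))) ⟩
    k ^ (b * n + 3 * N * n)
      ≡⟨ cong (k ^_) (*-distribʳ-+ n b (3 * N)) ⟨
    k ^ choices ∎
    where
    open ≤-Reasoning
    b = length (edges N)
    rearrange : ∀ n N → n * N + (n + n) * N ≡ 3 * N * n
    rearrange = solve-∀

  -- One step of the process: of `l` points, `p` candidates leave, at most `r` of them return, and
  -- at most `l′` points remain.
  module _ {l l′ p r : ℕ} (drop : l′ + p ≤ l + r) (many : n * q ≤ 2 * E * p)
           (few : r ≤ 2 * p / (q * q)) (p<k^Dq : p < k ^ (D * q)) where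

    private
      open ≤-Reasoning
      b = length (edges N)

      r*q*q≤2*p : r * (q * q) ≤ 2 * p
      r*q*q≤2*p = ≤-trans (*-monoˡ-≤ (q * q) few) (m/n*n≤m (2 * p) (q * q))

      2*r≤p : 2 * r ≤ p
      2*r≤p = *-cancelˡ-≤ 2 (begin
        2 * (2 * r)  ≡⟨ rearrange r ⟩
        r * (2 * 2)  ≤⟨ *-monoʳ-≤ r (*-mono-≤ 2≤q 2≤q) ⟩
        r * (q * q)  ≤⟨ r*q*q≤2*p ⟩
        2 * p        ∎)
        where
        rearrange : ∀ r → 2 * (2 * r) ≡ r * (2 * 2)
        rearrange = solve-∀

      -- At most half of the candidates return, so at least p / 2 points are lost for good.
      2*l′+p≤2*l : 2 * l′ + p ≤ 2 * l
      2*l′+p≤2*l = +-cancelʳ-≤ p (2 * l′ + p) (2 * l) (begin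
        2 * l′ + p + p   ≡⟨ rearrange₁ l′ p ⟩
        2 * (l′ + p)     ≤⟨ *-monoʳ-≤ 2 drop ⟩
        2 * (l + r)      ≡⟨ *-distribˡ-+ 2 l r ⟩
        2 * l + 2 * r    ≤⟨ +-monoʳ-≤ (2 * l) 2*r≤p ⟩
        2 * l + p        ∎)
        where
        rearrange₁ : ∀ l p → 2 * l + p + p ≡ 2 * (l + p)
        rearrange₁ = solve-∀

      listing : ℕ
      listing = D * q * r

      rate-bound : (choices + listing) * q + rate * l′ ≤ rate * l
      rate-bound = *-cancelˡ-≤ 2 (begin
        2 * (((b + 3 * N) * n + D * q * r) * q + rate * l′)
          ≡⟨ rearrange₁ (b + 3 * N) n D q r rate l′ ⟩
        2 * ((b + 3 * N) * (n * q) + D * (r * (q * q))) + rate * (2 * l′)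
          ≤⟨ +-monoˡ-≤ _ (*-monoʳ-≤ 2 (+-mono-≤ (*-monoʳ-≤ (b + 3 * N) many) (*-monoʳ-≤ D r*q*q≤2*p))) ⟩
        2 * ((b + 3 * N) * (2 * E * p) + D * (2 * p)) + rate * (2 * l′)
          ≡⟨ rearrange₂ (b + 3 * N) E p D l′ ⟩
        rate * (2 * l′ + p)
          ≤⟨ *-monoʳ-≤ rate 2*l′+p≤2*l ⟩
        rate * (2 * l)
          ≡⟨ rearrange₃ rate l ⟩
        2 * (rate * l) ∎)
        where
        rearrange₁ : ∀ s n D q r R l → 2 * ((s * n + D * q * r) * q + R * l)
                                     ≡ 2 * (s * (n * q) + D * (r * (q * q))) + R * (2 * l)
        rearrange₁ = solve-∀
        rearrange₂ : ∀ s E p D l → 2 * (s * (2 * E * p) + D * (2 * p)) + 4 * (E * s + D) * (2 * l)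
                                 ≡ 4 * (E * s + D) * (2 * l + p)
        rearrange₂ = solve-∀
        rearrange₃ : ∀ R l → R * (2 * l) ≡ 2 * (R * l)
        rearrange₃ = solve-∀

    shorter : l′ < l
    shorter = *-cancelˡ-< 2 l′ l (<-≤-trans (m<m+n (2 * l′) 0<p) 2*l′+p≤2*l)
      where
      0<n*q : 0 < n * q
      0<n*q = *-mono-≤ 0<n (≤-trans z<s 2≤q)
      0<p : 0 < p
      0<p = n≢0⇒n>0 λ { refl → <⇒≱ 0<n*q (≤-trans many (≤-reflexive (*-zeroʳ (2 * E)))) }

    budget-step : suc p ^ r * k ^ (budget l′ + choices) ≤ k ^ budget l
    budget-step = begin
      suc p ^ r * k ^ (budget l′ + choices)
        ≤⟨ *-monoˡ-≤ _ (^-monoˡ-≤ r p<k^Dq) ⟩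
      (k ^ (D * q)) ^ r * k ^ (budget l′ + choices)
        ≡⟨ cong (_* k ^ (budget l′ + choices)) (^-*-assoc k (D * q) r) ⟩
      k ^ listing * k ^ (budget l′ + choices)
        ≡⟨ ^-distribˡ-+-* k listing _ ⟨
      k ^ (listing + (budget l′ + choices))
        ≡⟨ cong (k ^_) (rearrange listing (budget l′) choices) ⟩
      k ^ (choices + listing + budget l′)
        ≤⟨ ^-monoʳ-≤ k (+-/-≤ (choices + listing) (rate * l′) (rate * l) rate-bound) ⟩
      k ^ budget l ∎
      where
      rearrange : ∀ a b c → a + (b + c) ≡ c + a + b
      rearrange = solve-∀

  points : List Point
  points = cartesianProduct pairs (allFin k)

  length-points : length points ≡ n * n * k
  length-points = trans (length-cartesianProductWith _,_ pairs (allFin k)) (cong₂ _*_ length-pairs (length-allFin k))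

  points-unique : Unique points
  points-unique = Unique.cartesianProduct⁺ pairs-unique (Unique.allFin⁺ k)

  ∈-points : ∀ v → v ∈ points
  ∈-points v = ∈-cartesianProduct⁺ (∈-cartesianProduct⁺ (∈-allFin _) (∈-allFin _)) (∈-allFin _)

  -- The extra `choices` in the exponent is for the guess made at `t` itself. The points lost after
  -- that guess pay for the listing and for the guess at the next template.
  containers : ∀ t → Acc _<_ (length t) → Unique t →
               Containers (λ c → c ∈ᵗ t × Free c) (k ^ (budget (length t) + choices))
  containers t (acc rec) t! with E * length (filter (hasCopy? t) maps) <? n ^ N
  ... | yes sparse =
    t ∷ [] , (λ c (c∈t , _) → here c∈t) , sparse ∷ [] , m^n>0 k (budget (length t) + choices)
  ... | no dense = weaken (λ c (c∈t , free) → informative t c t! dense c∈t free) count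
    (branch _ (All.universal (λ (e , es) → branch _ (All.universal (λ φ →
      weaken (λ _ → id) (≤-reflexive (cong (_* k ^ budget (length t)) (length-guesses φ)))
        (branch _ (All.universal (λ c′ → informed e es φ c′) (guesses φ)))) maps)) (splits (edges N))))
    where
    open ≤-Reasoning
    stars = (k ^ n * k ^ n) ^ N
    bound = k ^ budget (length t)
    length-maps : length maps ≡ n ^ N
    length-maps = trans (length-vecs (allFin n) N) (cong (_^ N) (length-allFin n))
    count : length (splits (edges N)) * (length maps * (stars * bound)) ≤ k ^ (budget (length t) + choices)
    count = begin
      length (splits (edges N)) * (length maps * (stars * bound))
        ≡⟨ cong₂ (λ x y → x * (y * (stars * bound))) (length-splits (edges N)) length-maps ⟩
      length (edges N) * (n ^ N * (stars * bound))
        ≡⟨ rearrange (length (edges N)) (n ^ N) stars bound ⟩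
      bound * (length (edges N) * (n ^ N * stars))
        ≤⟨ *-monoʳ-≤ bound choices-bound ⟩
      bound * k ^ choices
        ≡⟨ ^-distribˡ-+-* k (budget (length t)) choices ⟨
      k ^ (budget (length t) + choices) ∎
      where
      rearrange : ∀ b x y z → b * (x * (y * z)) ≡ z * (b * (x * y))
      rearrange = solve-∀
    informed : ∀ e es φ c′ → Containers (Informative t e es φ c′) (k ^ budget (length t))
    informed e es φ c′ with n * q ≤? 2 * E * length (candidates t c′ e es φ)
    -- The inequality concerns the guess alone; when it fails, no colouring is informative for this
    -- guess and the branch is empty.
    ... | no ¬many = [] , (λ c inf → ⊥-elim (¬many (Informative.many inf))) , [] , z≤n
    ... | yes many = weaken
      (λ c inf → lose (filter∈sublists (realised? c) r cands (Informative.few inf))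
                      (∈ᵗ-thin t c′ e es φ c (Informative.c∈t inf) , Informative.free inf))
      total
      (branch (λ s c → c ∈ᵗ thin t c′ e es φ s × Free c) (All.map thinned (All-length-sublists r cands)))
      where
      cands = candidates t c′ e es φ
      p r l′ : ℕ
      p = length cands
      r = 2 * p / (q * q)
      -- The subtraction is exact since p ≤ `length t`; this bounds all the thinned templates at
      -- once.
      l′ = length t + r ∸ p
      p≤l : p ≤ length t
      p≤l = length-filter (candidate? t c′ e es φ) t
      drop : l′ + p ≤ length t + r
      drop = ≤-reflexive (m∸n+n≡m (m≤n⇒m≤n+o r p≤l))
      p<k^Dq : p < k ^ (D * q)
      p<k^Dq = begin-strict
        p              ≤⟨ p≤l ⟩
        length t       ≤⟨ Unique-⊆⇒length-≤ t! (λ {v} _ → ∈-points v) ⟩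
        length points  ≡⟨ length-points ⟩
        n * n * k      <⟨ n*n*k<k^Dq ⟩
        k ^ (D * q)    ∎
      total : length (sublists r cands) * k ^ (budget l′ + choices) ≤ k ^ budget (length t)
      total = ≤-trans (*-monoˡ-≤ _ (length-sublists r cands)) (budget-step drop many ≤-refl p<k^Dq)
      thinned : ∀ {s} → length s ≤ r →
                Containers (λ c → c ∈ᵗ thin t c′ e es φ s × Free c) (k ^ (budget l′ + choices))
      thinned {s} s≤r = weaken (λ _ → id)
        (^-monoʳ-≤ k (+-monoˡ-≤ choices (/-monoˡ-≤ q (*-monoʳ-≤ rate thin≤l′))))
        (containers (thin t c′ e es φ s)
          (rec (≤-<-trans thin≤l′ (shorter drop many ≤-refl p<k^Dq))) (Unique.filter⁺ _ t!))
        where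
        thin≤l′ : length (thin t c′ e es φ s) ≤ l′
        thin≤l′ = m+n≤o⇒m≤o∸n _ (≤-trans (length-thin t c′ e es φ t! s) (+-monoʳ-≤ (length t) s≤r))

  all-containers : Containers Free (k ^ (rate * (n * n * k) / q + choices))
  all-containers = weaken (λ c free → (λ x y _ → ∈-points _) , free)
    (≤-reflexive (cong (λ l → k ^ (budget l + choices)) length-points))
    (containers points (<-wellFounded _) points-unique)

-- Increasing maps and N-sets.

lower : ∀ {m n} (φ : Fin m → Fin (suc n)) → (∀ i → zero ≢ φ i) → StrictlyMonotone φ →
        ∃[ ψ ] StrictlyMonotone ψ × ∀ i → suc (ψ i) ≡ φ i
lower {m} {n} φ 0≢φ mono = ψ , ψ-mono , suc∘ψ
  where
  ψ : Fin m → Fin n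
  ψ i = Fin.punchOut (0≢φ i)
  suc∘ψ : ∀ i → suc (ψ i) ≡ φ i
  suc∘ψ i = Fin.punchIn-punchOut (0≢φ i)
  ψ-mono : StrictlyMonotone ψ
  ψ-mono {i} {j} i<j = s<s⁻¹ (subst₂ Fin._<_ (sym (suc∘ψ i)) (sym (suc∘ψ j)) (mono i<j))

-- An increasing `φ` takes the value `zero` at index `zero` or nowhere. This decides whether `zero`
-- belongs to `S`; the other values are lowered by one.
enumerate-surjective : ∀ {N n} (φ : Fin N → Fin n) → StrictlyMonotone φ →
  ∃₂ λ (S : Subset n) (size : ∣ S ∣ ≡ N) → ∀ i → enumerate S (cast (sym size) i) ≡ φ i
enumerate-surjective {zero}  {n}     φ mono = ∅ , ∣⊥∣≡0 n , λ ()
enumerate-surjective {suc N} {zero}  φ mono with () ← φ zero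
enumerate-surjective {suc N} {suc n} φ mono with φ zero in φ0
... | zero  =
  let ψ , ψ-mono , suc∘ψ = lower (φ ∘ suc) 0≢φ (mono ∘ s<s)
      S , size , enum    = enumerate-surjective ψ ψ-mono
  in inside ∷ S , cong suc size , λ { zero → sym φ0 ; (suc i) → trans (cong suc (enum i)) (suc∘ψ i) }
  where
  0≢φ : ∀ i → zero ≢ φ (suc i)
  0≢φ i 0≡ = Fin.<⇒≢ (mono {zero} {suc i} z<s) (trans φ0 0≡)
... | suc x =
  let ψ , ψ-mono , suc∘ψ = lower φ 0≢φ mono
      S , size , enum    = enumerate-surjective ψ ψ-mono
  in outside ∷ S , size , λ i → trans (cong suc (enum i)) (suc∘ψ i)
  where
  0≢φ : ∀ i → zero ≢ φ i
  0≢φ zero    0≡ with () ← trans 0≡ φ0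
  0≢φ (suc i) 0≡ with () ← subst (φ zero Fin.<_) (sym 0≡) (mono {zero} {suc i} z<s)

enumerate-injective : ∀ {n} (A B : Subset n) (eq : ∣ A ∣ ≡ ∣ B ∣) →
  (∀ i → enumerate A i ≡ enumerate B (cast eq i)) → A ≡ B
enumerate-injective []            []            _  _    = refl
enumerate-injective (inside ∷ A)  (inside ∷ B)  eq same =
  cong (inside ∷_) (enumerate-injective A B (suc-injective eq) (λ i → Fin.suc-injective (same (suc i))))
enumerate-injective (outside ∷ A) (outside ∷ B) eq same =
  cong (outside ∷_) (enumerate-injective A B eq (λ i → Fin.suc-injective (same i)))
enumerate-injective (inside ∷ A)  (outside ∷ B) eq same with () ← same zero
enumerate-injective (outside ∷ A) (inside ∷ B)  eq same with () ← trans (same (cast (sym eq) zero))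
  (cong (enumerate (inside ∷ B)) (Fin.cast-involutive eq (sym eq) zero))

elements : ∀ {N n} → SetOfSize N n → Vec (Fin n) N
elements A = Vec.tabulate (element A)

elements-injective : ∀ {N n} {A B : SetOfSize N n} → elements A ≡ elements B → A ≡ B
elements-injective {N} {A = A of-size p} {B of-size q} eq = of-size-cong (enumerate-injective A B eq′ same)
  where
  p′ : ∣ A ∣ ≡ N
  p′ = recompute (∣ A ∣ ≟ N) p
  q′ : ∣ B ∣ ≡ N
  q′ = recompute (∣ B ∣ ≟ N) q
  eq′ : ∣ A ∣ ≡ ∣ B ∣
  eq′ = trans p′ (sym q′)
  of-size-cong : ∀ {A B : Subset _} .{p : ∣ A ∣ ≡ N} .{q : ∣ B ∣ ≡ N} → A ≡ B → (A of-size p) ≡ (B of-size q)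
  of-size-cong refl = refl
  pointwise : ∀ i → element (A of-size p) i ≡ element (B of-size q) i
  pointwise i = trans (sym (lookup∘tabulate (element (A of-size p)) i))
    (trans (cong (λ v → lookup v i) eq) (lookup∘tabulate (element (B of-size q)) i))
  same : ∀ i → enumerate A i ≡ enumerate B (cast eq′ i)
  same i = trans (cong (enumerate A) (sym (Fin.cast-involutive (sym p′) p′ i)))
    (trans (pointwise (cast p′ i)) (cong (enumerate B) (Fin.cast-trans p′ (sym q′) i)))

-- Binomial estimates and integer roots.

absorption : ∀ n m → suc n * (n C m) ≡ suc m * (suc n C suc m)
absorption n       zero    =
  trans (*-identityʳ (suc n)) (sym (trans (*-identityˡ (suc n C 1)) (nC1≡n (suc n))))
absorption zero    (suc m) =
  sym (trans (cong (suc (suc m) *_) (k>n⇒nCk≡0 {1} {2 + m} (s<s z<s))) (*-zeroʳ (suc (suc m))))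
absorption (suc n) (suc m) = begin
  suc (suc n) * a                            ≡⟨ cong (λ x → a + suc n * x) (nCk+nC[k+1]≡[n+1]C[k+1] n m) ⟨
  a + suc n * (n C m + n C suc m)            ≡⟨ cong (a +_) (*-distribˡ-+ (suc n) (n C m) (n C suc m)) ⟩
  a + (suc n * (n C m) + suc n * (n C suc m))
    ≡⟨ cong₂ (λ x y → a + (x + y)) (absorption n m) (absorption n (suc m)) ⟩
  a + (suc m * a + suc (suc m) * b)          ≡⟨ +-assoc a _ _ ⟨
  suc (suc m) * a + suc (suc m) * b          ≡⟨ *-distribˡ-+ (suc (suc m)) a b ⟨
  suc (suc m) * (a + b)                      ≡⟨ cong (suc (suc m) *_) (nCk+nC[k+1]≡[n+1]C[k+1] (suc n) (suc m)) ⟩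
  suc (suc m) * (suc (suc n) C suc (suc m))  ∎
  where
  open ≡-Reasoning
  a = suc n C suc m
  b = suc n C suc (suc m)

-- That is, (n/N)^N ≤ C(n,N). The induction step is absorption together with (n+1)/(N+1) ≤ n/N for N
-- ≤ n; the factor `N ^ N` clears denominators and is 1 at N = 0.
n^N≤N^N*nCN : ∀ {N n} → N ≤ n → n ^ N ≤ N ^ N * (n C N)
n^N≤N^N*nCN {zero}  {n}     _         = ≤-refl
n^N≤N^N*nCN {suc N} {suc n} (s≤s N≤n) = *-cancelˡ-≤ (N ^ N) {{N^N≢0 N}} (begin
  N ^ N * (suc n * suc n ^ N)                      ≡⟨ rearrange₁ (N ^ N) (suc n) (suc n ^ N) ⟩
  suc n * (N ^ N * suc n ^ N)                      ≡⟨ cong (suc n *_) (^-distribʳ-* N (suc n) N) ⟨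
  suc n * (N * suc n) ^ N                          ≤⟨ *-monoʳ-≤ (suc n) (^-monoˡ-≤ N N*[1+n]≤[1+N]*n) ⟩
  suc n * (suc N * n) ^ N                          ≡⟨ cong (suc n *_) (^-distribʳ-* (suc N) n N) ⟩
  suc n * (suc N ^ N * n ^ N)                      ≤⟨ *-monoʳ-≤ (suc n) (*-monoʳ-≤ (suc N ^ N) (n^N≤N^N*nCN N≤n)) ⟩
  suc n * (suc N ^ N * (N ^ N * (n C N)))          ≡⟨ rearrange₂ (suc n) (suc N ^ N) (N ^ N) (n C N) ⟩
  N ^ N * (suc N ^ N * (suc n * (n C N)))          ≡⟨ cong (λ x → N ^ N * (suc N ^ N * x)) (absorption n N) ⟩
  N ^ N * (suc N ^ N * (suc N * (suc n C suc N)))  ≡⟨ rearrange₃ (N ^ N) (suc N ^ N) (suc N) (suc n C suc N) ⟩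
  N ^ N * (suc N * suc N ^ N * (suc n C suc N))    ∎)
  where
  open ≤-Reasoning
  N^N≢0 : ∀ N → NonZero (N ^ N)
  N^N≢0 zero    = _
  N^N≢0 (suc N) = m^n≢0 (suc N) (suc N)
  N*[1+n]≤[1+N]*n : N * suc n ≤ suc N * n
  N*[1+n]≤[1+N]*n = ≤-trans (≤-reflexive (*-suc N n)) (+-monoˡ-≤ (N * n) N≤n)
  ^-distribʳ-* : ∀ x y m → (x * y) ^ m ≡ x ^ m * y ^ m
  ^-distribʳ-* x y zero    = refl
  ^-distribʳ-* x y (suc m) = trans (cong (x * y *_) (^-distribʳ-* x y m)) (rearrange x y (x ^ m) (y ^ m))
    where
    rearrange : ∀ a b c d → a * b * (c * d) ≡ a * c * (b * d)
    rearrange = solve-∀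
  rearrange₁ : ∀ a b c → a * (b * c) ≡ b * (a * c)
  rearrange₁ = solve-∀
  rearrange₂ : ∀ a b c d → a * (b * (c * d)) ≡ c * (b * (a * d))
  rearrange₂ = solve-∀
  rearrange₃ : ∀ a b c d → a * (b * (c * d)) ≡ a * (c * b * d)
  rearrange₃ = solve-∀
n*n≤4*nC2 : ∀ {n} → 2 ≤ n → n * n ≤ 4 * (n C 2)
n*n≤4*nC2 {suc n} (s≤s 1≤n) = begin
  suc n * suc n        ≤⟨ *-monoʳ-≤ (suc n) (+-monoˡ-≤ n 1≤n) ⟩
  suc n * (n + n)      ≡⟨ rearrange n ⟩
  2 * (suc n * n)      ≡⟨ cong (2 *_) (2*nC2 n) ⟨
  2 * (2 * (suc n C 2))  ≡⟨ *-assoc 2 2 (suc n C 2) ⟨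
  4 * (suc n C 2)        ∎
  where
  open ≤-Reasoning
  rearrange : ∀ n → suc n * (n + n) ≡ 2 * (suc n * n)
  rearrange = solve-∀
  2*nC2 : ∀ n → 2 * (suc n C 2) ≡ suc n * n
  2*nC2 n = trans (sym (absorption n 1)) (cong (suc n *_) (nC1≡n n))

-- When n grows by one, its integer root grows by at most one.
root : ∀ m .{{_ : NonZero m}} n → ∃[ q ] q ^ m ≤ n × n < suc q ^ m
root m@(suc _) zero = 0 , ≤-refl , m^n>0 1 m
root m (suc n) with q , q^m≤n , n<[1+q]^m ← root m n with suc q ^ m ≤? suc n
... | yes le = suc q , le , ≤-<-trans n<[1+q]^m (^-monoˡ-< m (n<1+n (suc q)))
... | no ≰   = q , m≤n⇒m≤1+n q^m≤n , ≰⇒> ≰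

-- From matrices and point lists back to colourings and templates.

module Translate {k N n : ℕ} (d₀ : Fin k) (F : List (Colouring k N)) where

  open Core {n = n} d₀ F
  open DecMembership _≟ᵖ_ using (_∈?_)

  toMatrix : Colouring k n → Matrix
  toMatrix c x y with x Fin.<? y
  ... | yes x<y = c (edge x y x<y)
  ... | no _    = d₀

  toMatrix-edge : ∀ c e → toMatrix c (Edge.i e) (Edge.j e) ≡ c e
  toMatrix-edge c (edge x y x<y) with x Fin.<? y
  ... | yes _  = refl
  ... | no x≮y = ⊥-elim-irr (x≮y x<y)

  forb⇒free : ∀ c → Forb F n c → Free (toMatrix c)
  forb⇒free c forb φ increasing found with A , size , enum ← enumerate-surjective (lookup φ) increasing =
    forb (A of-size size) (Any.map (λ eq e → trans (sym (toMatrix-edge c (embed (A of-size size) e)))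
      (trans (cong₂ (toMatrix c) (enum (Edge.i e)) (enum (Edge.j e))) (eq e))) found)

  -- Thinning can remove every colour of an edge. Such a list contains no colouring and is discarded
  -- in `translate`.
  NonemptyPoints : List Point → Set
  NonemptyPoints t = ∀ x y → x Fin.< y → ∃[ d ] ((x , y) , d) ∈ t

  nonemptyPoints? : ∀ t → Dec (NonemptyPoints t)
  nonemptyPoints? t = Fin.all? λ x → Fin.all? λ y → (x Fin.<? y) →-dec Fin.any? λ d → ((x , y) , d) ∈? t

  coloursAt : List Point → Fin n × Fin n → Subset k
  coloursAt t p = Vec.tabulate (λ d → does ((p , d) ∈? t))

  ∈-coloursAt⁺ : ∀ {t p d} → (p , d) ∈ t → d ∈ˢ coloursAt t p
  ∈-coloursAt⁺ {t} {p} {d} ∈t = lookup⇒[]= d _ (trans (lookup∘tabulate _ d) (dec-true ((p , d) ∈? t) ∈t))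

  ∈-coloursAt⁻ : ∀ {t p d} → d ∈ˢ coloursAt t p → (p , d) ∈ t
  ∈-coloursAt⁻ {t} {p} {d} d∈
    with (p , d) ∈? t | trans (sym (lookup∘tabulate (λ d → does ((p , d) ∈? t)) d)) ([]=⇒lookup d∈)
  ... | yes ∈t | _ = ∈t
  ... | no _   | ()

  toTemplate : ∀ t → NonemptyPoints t → Template k n
  toTemplate t ne = record
    { colours  = λ e → coloursAt t (Edge.i e , Edge.j e)
    ; nonempty = λ { (edge x y x<y) → map₂ ∈-coloursAt⁺ (ne x y (recompute (x Fin.<? y) x<y)) }
    }

  -- An N-set is determined by its increasing enumeration, and this enumeration is one of the maps
  -- with a copy in `t`.
  few-copies : ∀ t (ne : NonemptyPoints t) xs → Unique xs → All (ContainsMemberOf F (toTemplate t ne)) xs →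
               length xs ≤ length (filter (hasCopy? t) maps)
  few-copies t ne xs xs! copies = subst (_≤ length (filter (hasCopy? t) maps)) (length-map elements xs)
    (Unique-⊆⇒length-≤ (Unique.map⁺ elements-injective xs!) elements⊆)
    where
    hasCopy : ∀ {A} → ContainsMemberOf F (toTemplate t ne) A → HasCopy t (elements A)
    hasCopy {A} (c , c∈F , c∈t) = Any.map (λ {f} c≗f → All.tabulate λ {e} _ → copied f c≗f e) c∈F
      where
      copied : ∀ f → (∀ e → c e ≡ f e) → ∀ e →
               lookup (elements A) (Edge.i e) Fin.< lookup (elements A) (Edge.j e)
               × (ends (elements A) e , f e) ∈ t
      copied f c≗f e@(edge i j i<j) rewrite lookup∘tabulate (element A) i | lookup∘tabulate (element A) j =
        element-mono A (recompute (i Fin.<? j) i<j) , subst (λ d → (_ , d) ∈ t) (c≗f e) (∈-coloursAt⁻ (c∈t e))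
    elements⊆ : ∀ {v} → v ∈ map elements xs → v ∈ filter (hasCopy? t) maps
    elements⊆ v∈ with A , A∈xs , refl ← ∈-map⁻ elements v∈ =
      ∈-filter⁺ (hasCopy? t) (∈-vecs ∈-allFin (elements A)) (hasCopy {A} (All.lookup copies A∈xs))

  translate : ∀ {b} T → All (λ t → length (filter (hasCopy? t) maps) ≤ b) T →
    ∃[ T′ ] (∀ c → Any (toMatrix c ∈ᵗ_) T → Any (c ∈⟨_⟩) T′)
          × All (λ t → ∀ xs → Unique xs → All (ContainsMemberOf F t) xs → length xs ≤ b) T′
          × length T′ ≤ length T
  translate [] [] = [] , (λ _ ()) , [] , z≤n
  translate (t ∷ T) (few ∷ fews) with translate T fews | nonemptyPoints? t
  ... | T′ , covers , few′ , small | yes ne =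
    toTemplate t ne ∷ T′
    , (λ { c (here c∈t)  → here λ { e@(edge x y x<y) → ∈-coloursAt⁺
             (subst (λ d → (_ , d) ∈ t) (toMatrix-edge c e) (c∈t x y (recompute (x Fin.<? y) x<y))) }
         ; c (there c∈T) → there (covers c c∈T) })
    , (λ xs xs! copies → ≤-trans (few-copies t ne xs xs! copies) few) ∷ few′
    , s≤s small
  ... | T′ , covers , few′ , small | no ¬ne =
    T′
    , (λ { c (here c∈t)  → ⊥-elim (¬ne λ x y x<y → toMatrix c x y , c∈t x y x<y)
         ; c (there c∈T) → covers c c∈T })
    , few′
    , m≤n⇒m≤1+n small

-- Since n^N ≤ N^N C(n,N), the choice E = v N^N turns fewer than n^N / E copies
-- into at most C(n,N) / v; n ≥ 2^m makes q ≥ 2.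

finite-containers : ∀ k N b v → 2 ≤ k → 0 < N → 0 < v → N C 2 ≡ suc b →
  ∃₂ λ K n₀ → ∀ (F : List (Colouring k N)) n → n₀ ≤ n → ∃[ T ]
    IsContainerFamily T (Forb F n)
    × All (λ t → ∀ xs → Unique xs → All (ContainsMemberOf F t) xs → length xs * v ≤ n C N) T
    × ∃₂ λ L q → length T ≤ k ^ L × n < (2 * q) ^ suc (2 * b) × L * q ≤ K * (n C 2)
finite-containers k N b v 2≤k 0<N 0<v NC2≡1+b = K , 2 ^ m + N , result
  where
  open ≤-Reasoning
  m D E s rate K : ℕ
  -- As C(N,2) = b + 1 here, this is 2 C(N,2) - 1.
  m = suc (2 * b)
  -- From n < k^(q m) follows n^2 k < k^(2 m q + 1), and 1 ≤ q.
  D = suc (2 * m)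
  E = v * N ^ N
  s = length (edges N) + 3 * N
  rate = 4 * (E * s + D)
  -- The exponent L satisfies L q ≤ (rate k + s) n^2, and n^2 ≤ 4 C(n,2).
  K = 4 * (rate * k + s)
  instance
    k≢0 : NonZero k
    k≢0 = >-nonZero (≤-trans z<s 2≤k)
    v≢0 : NonZero v
    v≢0 = >-nonZero 0<v
    N^N≢0 : NonZero (N ^ N)
    N^N≢0 = m^n≢0 N N {{>-nonZero 0<N}}
  module _ (F : List (Colouring k N)) (n : ℕ) (n₀≤n : 2 ^ m + N ≤ n) where
    2^m≤n : 2 ^ m ≤ n
    2^m≤n = m+n≤o⇒m≤o (2 ^ m) n₀≤n
    N≤n : N ≤ n
    N≤n = m+n≤o⇒n≤o (2 ^ m) n₀≤n
    2≤n : 2 ≤ n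
    2≤n = ≤-trans (^-monoʳ-≤ 2 {1} {m} (s≤s z≤n)) 2^m≤n
    d₀ : Fin k
    d₀ = Fin.fromℕ< (≤-trans z<s 2≤k)
    q : ℕ
    q = proj₁ (root m n)
    q^m≤n : q ^ m ≤ n
    q^m≤n = proj₁ (proj₂ (root m n))
    n<[1+q]^m : n < suc q ^ m
    n<[1+q]^m = proj₂ (proj₂ (root m n))
    2≤q : 2 ≤ q
    2≤q = s≤s⁻¹ (≰⇒> λ 1+q≤2 → <⇒≱ n<[1+q]^m (≤-trans (^-monoˡ-≤ m 1+q≤2) 2^m≤n))
    instance
      q≢0 : NonZero q
      q≢0 = >-nonZero (≤-trans z<s 2≤q)
    q≤n : q ≤ n
    q≤n = ≤-trans (≤-trans (≤-reflexive (sym (^-identityʳ q))) (^-monoʳ-≤ q {1} {m} (s≤s z≤n))) q^m≤n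
    power≤n : ∀ {j} → j < length (edges N) → q ^ suc (2 * j) ≤ n
    power≤n {j} j<edges = ≤-trans (^-monoʳ-≤ q (s≤s (*-monoʳ-≤ 2 j≤b))) q^m≤n
      where
      j≤b : j ≤ b
      j≤b = s≤s⁻¹ (≤-trans j<edges (≤-reflexive (trans (length-edges N) NC2≡1+b)))
    n<k^qm : n < k ^ (q * m)
    n<k^qm = <-≤-trans n<[1+q]^m (≤-trans (^-monoˡ-≤ m (n<k^n 2≤k q)) (≤-reflexive (^-*-assoc k q m)))
    n*n*k<k^Dq : n * n * k < k ^ (D * q)
    n*n*k<k^Dq = begin-strict
      n * n * k                            <⟨ *-monoˡ-< k (*-mono-< n<k^qm n<k^qm) ⟩
      k ^ (q * m) * k ^ (q * m) * k        ≡⟨ cong (_* k) (^-distribˡ-+-* k (q * m) (q * m)) ⟨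
      k ^ (q * m + q * m) * k              ≡⟨ *-comm _ k ⟩
      k ^ suc (q * m + q * m)
        ≤⟨ ^-monoʳ-≤ k (+-mono-≤ (≤-trans z<s 2≤q) (≤-reflexive (rearrange q m))) ⟩
      k ^ (q + 2 * m * q)                  ∎
      where
      rearrange : ∀ q m → q * m + q * m ≡ 2 * m * q
      rearrange = solve-∀
    open Core {n = n} d₀ F
    open Build {n = n} d₀ F E q D 2≤k (≤-trans z<s 2≤n) (>-nonZero⁻¹ E {{m*n≢0 v (N ^ N)}}) 2≤q power≤n n*n*k<k^Dq
      using (all-containers)
    open Translate {n = n} d₀ F
    T : List (List Point)
    T = proj₁ all-containers
    few : ∀ {x} → E * x < n ^ N → x ≤ (n C N) / v
    few {x} sparse = ≤-trans (≤-reflexive (sym (m*n/n≡m x v))) (/-monoˡ-≤ v (*-cancelˡ-≤ (N ^ N) (begin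
      N ^ N * (x * v)    ≡⟨ rearrange v (N ^ N) x ⟩
      E * x              ≤⟨ <⇒≤ sparse ⟩
      n ^ N              ≤⟨ n^N≤N^N*nCN N≤n ⟩
      N ^ N * (n C N)    ∎)))
      where
      rearrange : ∀ v y x → y * (x * v) ≡ v * y * x
      rearrange = solve-∀
    translated = translate T (All.map few (proj₁ (proj₂ (proj₂ all-containers))))
    L : ℕ
    L = rate * (n * n * k) / q + s * n
    L*q≤K*nC2 : L * q ≤ K * (n C 2)
    L*q≤K*nC2 = begin
      L * q
        ≡⟨ *-distribʳ-+ q (rate * (n * n * k) / q) (s * n) ⟩
      rate * (n * n * k) / q * q + s * n * q
        ≤⟨ +-mono-≤ (m/n*n≤m (rate * (n * n * k)) q) (*-monoʳ-≤ (s * n) q≤n) ⟩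
      rate * (n * n * k) + s * n * n
        ≡⟨ rearrange₁ rate n k s ⟩
      (rate * k + s) * (n * n)
        ≤⟨ *-monoʳ-≤ (rate * k + s) (n*n≤4*nC2 2≤n) ⟩
      (rate * k + s) * (4 * (n C 2))
        ≡⟨ rearrange₂ (rate * k + s) (n C 2) ⟩
      K * (n C 2) ∎
      where
      rearrange₁ : ∀ r n k s → r * (n * n * k) + s * n * n ≡ (r * k + s) * (n * n)
      rearrange₁ = solve-∀
      rearrange₂ : ∀ a x → a * (4 * x) ≡ 4 * a * x
      rearrange₂ = solve-∀
    result : ∃[ T ]
      IsContainerFamily T (Forb F n)
      × All (λ t → ∀ xs → Unique xs → All (ContainsMemberOf F t) xs → length xs * v ≤ n C N) T
      × ∃₂ λ L q → length T ≤ k ^ L × n < (2 * q) ^ suc (2 * b) × L * q ≤ K * (n C 2)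
    result = proj₁ translated
      , (λ c forb → proj₁ (proj₂ translated) c (proj₁ (proj₂ all-containers) (toMatrix c) (forb⇒free c forb)))
      , All.map (λ bound xs xs! copies → ≤-trans (*-monoˡ-≤ v (bound xs xs! copies)) (m/n*n≤m (n C N) v))
                (proj₁ (proj₂ (proj₂ translated)))
      , L , q
      , ≤-trans (proj₂ (proj₂ (proj₂ translated))) (proj₂ (proj₂ (proj₂ all-containers)))
      -- Since q + 1 ≤ 2q, rounding the root down costs only a factor 2.
      , <-≤-trans n<[1+q]^m (^-monoˡ-≤ m (+-mono-≤ (≤-trans z<s 2≤q) (≤-reflexive (sym (+-identityʳ q)))))
      , L*q≤K*nC2

-- Rational inequalities, logarithms and cuts.

fromℕ-* : ∀ a b → fromℕ (a * b) ≡ fromℕ a ℚ.* fromℕ b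
fromℕ-* a b = ℚ.toℚᵘ-injective (ℚᵘ.≃-sym (ℚᵘ.≃-trans (ℚ.toℚᵘ-homo-* (fromℕ a) (fromℕ b))
  (*≡* (cong (ℤ._* ℤ.+ 1) (sym (ℤ.pos-* a b))))))

fromℕ-mono-≤ : ∀ {a b} → a ≤ b → fromℕ a ℚ.≤ fromℕ b
fromℕ-mono-≤ a≤b = *≤* (ℤ.*-monoʳ-≤-nonNeg (ℤ.+ 1) (ℤ.+≤+ a≤b))

fromℕ-mono-< : ∀ {a b} → a < b → fromℕ a ℚ.< fromℕ b
fromℕ-mono-< a<b = *<* (ℤ.*-monoʳ-<-pos (ℤ.+ 1) (ℤ.+<+ a<b))

fromℕ-^ : ∀ a m → fromℕ a ^ᵠ m ≡ fromℕ (a ^ m)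
fromℕ-^ a zero    = refl
fromℕ-^ a (suc m) = trans (cong (fromℕ a ℚ.*_) (fromℕ-^ a m)) (sym (fromℕ-* a (a ^ m)))

0≤fromℕ : ∀ a → 0ℚ ℚ.≤ fromℕ a
0≤fromℕ a = fromℕ-mono-≤ {0} {a} z≤n

0≤* : ∀ {p q} → 0ℚ ℚ.≤ p → 0ℚ ℚ.≤ q → 0ℚ ℚ.≤ p ℚ.* q
0≤* {p} {q} 0≤p 0≤q = ℚ.nonNegative⁻¹ (p ℚ.* q)
  {{ℚ.nonNeg*nonNeg⇒nonNeg p {{ℚ.nonNegative 0≤p}} q {{ℚ.nonNegative 0≤q}}}}

^ᵠ-≤1 : ∀ {p} → 0ℚ ℚ.≤ p → p ℚ.≤ 1ℚ → ∀ m → p ^ᵠ m ℚ.≤ 1ℚ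
^ᵠ-≤1     0≤p p≤1 zero    = ℚ.≤-refl
^ᵠ-≤1 {p} 0≤p p≤1 (suc m) = begin
  p ℚ.* p ^ᵠ m  ≤⟨ ℚ.*-monoˡ-≤-nonNeg p {{ℚ.nonNegative 0≤p}} (^ᵠ-≤1 0≤p p≤1 m) ⟩
  p ℚ.* 1ℚ      ≡⟨ ℚ.*-identityʳ p ⟩
  p             ≤⟨ p≤1 ⟩
  1ℚ            ∎
  where open ℚ.≤-Reasoning

-- For s = u/v the hypothesis reads L v < u, so u is positive and M^v ≤ k^(L v) < k^u. The case M =
-- 0 is included.
log-< : ∀ k .{{_ : NonTrivial k}} {M L s} → M ≤ k ^ L → fromℕ L ℚ.< s → log k M s
log-< k {M} {L} {mkℚ -[1+ u ] d _} M≤k^L (*<* L<s)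
  with () ← subst (ℤ._< -[1+ u ] ℤ.* ℤ.+ 1) (sym (ℤ.pos-* L (suc d))) L<s
log-< k {M} {L} {mkℚ (ℤ.+ u) d _} M≤k^L (*<* L<s) =
  subst₂ ℚ._<_ (sym (fromℕ-^ M (suc d))) (sym (fromℕ-^ k u)) (fromℕ-mono-< (begin-strict
    M ^ suc d          ≤⟨ ^-monoˡ-≤ (suc d) M≤k^L ⟩
    (k ^ L) ^ suc d    ≡⟨ ^-*-assoc k L (suc d) ⟩
    k ^ (L * suc d)    <⟨ ^-monoʳ-< k (nonTrivial⇒n>1 k) L*[1+d]<u ⟩
    k ^ u              ∎))
  where
  open ≤-Reasoning
  L*[1+d]<u : L * suc d < u
  L*[1+d]<u = ℤ.drop‿+<+ (subst₂ ℤ._<_ (sym (ℤ.pos-* L (suc d))) (ℤ.*-identityʳ (ℤ.+ u)) L<s)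

n*1/n≡1 : ∀ v .{{_ : NonZero v}} → fromℕ v ℚ.* (1/ fromℕ v) ≡ 1ℚ
n*1/n≡1 v = ℚ.*-inverseʳ (fromℕ v)

lower<upper : ∀ (x : ℝ) {p q} → ℝ.lower x p → ℝ.upper x q → p ℚ.< q
lower<upper x {p} {q} lp uq with ℚ.<-cmp p q
... | tri< p<q _ _  = p<q
... | tri≈ _ refl _ = ⊥-elim (ℝ.disjoint x p (lp , uq))
... | tri> _ _ q<p  = ⊥-elim (ℝ.disjoint x q (Equivalence.from (ℝ.lower-rounded x q) (p , q<p , lp) , uq))

-- A positive fraction has numerator at least 1, so its own denominator serves.
reciprocal-bound : ∀ p → 0ℚ ℚ.< p → ∃[ v ] 1/ fromℕ (suc v) ℚ.≤ p
reciprocal-bound (mkℚ (ℤ.+ u) d _)  (*<* 0<u) =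
  d , *≤* (ℤ.*-monoʳ-≤-nonNeg +[1+ d ] (ℤ.i<j⇒suc[i]≤j (subst (ℤ.0ℤ ℤ.<_) (ℤ.*-identityʳ (ℤ.+ u)) 0<u)))
reciprocal-bound (mkℚ -[1+ u ] d _) (*<* ())

-- Roundedness at 0 gives a positive rational below `ε`. Only `v` enters the constants later.
Positive⇒reciprocal : ∀ ε → Positiveℝ ε → ∃[ v ] ∀ {r} → ℝ.upper ε r → 1/ fromℕ (suc v) ℚ.≤ r
Positive⇒reciprocal ε ε>0 =
  let p , 0<p , lp = Equivalence.to (ℝ.lower-rounded ε 0ℚ) ε>0
      v , 1/v≤p    = reciprocal-bound p 0<p
  in v , λ ur → ℚ.≤-trans 1/v≤p (ℚ.<⇒≤ (lower<upper ε lp ur))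

atMost-· : ∀ {A : Set} {P : A → Set} c v {x : Cut} → (∀ {r} → x r → 1/ fromℕ (suc v) ℚ.≤ r) →
           (∀ xs → Unique xs → All P xs → length xs * suc v ≤ c) → AtMost (fromℕ c · x) P
atMost-· c v 1/v≤x bound xs xs! Pxs s (r , xr , c*r<s) = begin-strict
  fromℕ l                                     ≡⟨ ℚ.*-identityʳ (fromℕ l) ⟨
  fromℕ l ℚ.* 1ℚ                              ≡⟨ cong (fromℕ l ℚ.*_) (n*1/n≡1 (suc v)) ⟨
  fromℕ l ℚ.* (fromℕ (suc v) ℚ.* δ)           ≡⟨ ℚ.*-assoc (fromℕ l) (fromℕ (suc v)) δ ⟨
  fromℕ l ℚ.* fromℕ (suc v) ℚ.* δ             ≡⟨ cong (ℚ._* δ) (fromℕ-* l (suc v)) ⟨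
  fromℕ (l * suc v) ℚ.* δ                     ≤⟨ ℚ.*-monoʳ-≤-nonNeg δ (fromℕ-mono-≤ (bound xs xs! Pxs)) ⟩
  fromℕ c ℚ.* δ                               ≤⟨ ℚ.*-monoˡ-≤-nonNeg (fromℕ c) (1/v≤x xr) ⟩
  fromℕ c ℚ.* r                               <⟨ c*r<s ⟩
  s                                           ∎
  where
  open ℚ.≤-Reasoning
  l = length xs
  δ = 1/ fromℕ (suc v)

containerExponent≡ : ∀ N b → N C 2 ≡ suc b → containerExponent N ≡ ℚ.- (1/ fromℕ (suc (2 * b)))
containerExponent≡ N b eq = negated-reciprocal (2b-1 (N C 2)) {{2b-1≢0 (N C 2)}}
  (trans (cong 2b-1 eq) (cong ℤ.+_ (+-suc b (b + 0))))
  where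
  negated-reciprocal : ∀ z .{{_ : ℤ.NonZero z}} → z ≡ +[1+ 2 * b ] →
                       ℚ.- (1/ fromℤ z) ≡ ℚ.- (1/ fromℕ (suc (2 * b)))
  negated-reciprocal _ refl = refl

-- If Q r < 1, then (Q r)^m ≤ 1, whereas n < Q^m and 1/n < r^m push it above 1. The power `1` is the
-- form that the numerator -1 takes in `power`.
root-bound : ∀ n .{{_ : NonZero n}} m Q {r} → n < Q ^ m → 0ℚ ℚ.< r →
             (1/ fromℕ n) ^ᵠ 1 ℚ.< r ^ᵠ m → 1ℚ ℚ.≤ fromℕ Q ℚ.* r
root-bound n m Q {r} n<Q^m 0<r 1/n<r^m = ℚ.≮⇒≥ λ Qr<1 → ℚ.<-irrefl refl (begin-strict
  1ℚ                             ≡⟨ n*1/n≡1 n ⟨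
  fromℕ n ℚ.* (1/ fromℕ n)       ≡⟨ cong (fromℕ n ℚ.*_) (ℚ.*-identityʳ (1/ fromℕ n)) ⟨
  fromℕ n ℚ.* (1/ fromℕ n) ^ᵠ 1  <⟨ ℚ.*-monoʳ-<-pos (fromℕ n) {{0<fromℕ}} 1/n<r^m ⟩
  fromℕ n ℚ.* r ^ᵠ m             ≤⟨ ℚ.*-monoʳ-≤-nonNeg (r ^ᵠ m) {{ℚ.nonNegative (0≤^ m)}} (fromℕ-mono-≤ (<⇒≤ n<Q^m)) ⟩
  fromℕ (Q ^ m) ℚ.* r ^ᵠ m       ≡⟨ cong (ℚ._* r ^ᵠ m) (fromℕ-^ Q m) ⟨
  fromℕ Q ^ᵠ m ℚ.* r ^ᵠ m        ≡⟨ ^-distrib-* (fromℕ Q) r m ⟨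
  (fromℕ Q ℚ.* r) ^ᵠ m           ≤⟨ ^ᵠ-≤1 0≤Qr (ℚ.<⇒≤ Qr<1) m ⟩
  1ℚ                             ∎)
  where
  open ℚ.≤-Reasoning
  0≤r = ℚ.<⇒≤ 0<r
  0<fromℕ : ℚ.Positive (fromℕ n)
  0<fromℕ = ℚ.positive (fromℕ-mono-< (>-nonZero⁻¹ n))
  0≤^ : ∀ m → 0ℚ ℚ.≤ r ^ᵠ m
  0≤^ zero    = 0≤fromℕ 1
  0≤^ (suc m) = 0≤* 0≤r (0≤^ m)
  0≤Qr : 0ℚ ℚ.≤ fromℕ Q ℚ.* r
  0≤Qr = 0≤* (0≤fromℕ Q) 0≤r

-- A rational r above n^(-1/(2b+1)) satisfies 1 ≤ 2 q r, so L ≤ 2 L q r, which is at most 2 K C(n,2)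
-- r.
log-bound : ∀ k .{{_ : NonTrivial k}} n .{{_ : NonZero n}} N b {K L M q} → N C 2 ≡ suc b →
  M ≤ k ^ L → n < (2 * q) ^ suc (2 * b) → L * q ≤ K * (n C 2) →
  log k M ≼ (fromℕ (suc (2 * K)) ℚ.* fromℕ (n C 2)) · power n (containerExponent N)
log-bound k n N b {K} {L} {M} {q} NC2≡1+b M≤k^L n<[2q]^m Lq≤KB s (r , pow , bound) =
  log-< k M≤k^L (begin-strict
  fromℕ L                              ≡⟨ ℚ.*-identityʳ (fromℕ L) ⟨
  fromℕ L ℚ.* 1ℚ                       ≤⟨ ℚ.*-monoˡ-≤-nonNeg (fromℕ L) 1≤2qr ⟩
  fromℕ L ℚ.* (fromℕ (2 * q) ℚ.* r)    ≡⟨ ℚ.*-assoc (fromℕ L) (fromℕ (2 * q)) r ⟨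
  fromℕ L ℚ.* fromℕ (2 * q) ℚ.* r      ≡⟨ cong (ℚ._* r) (fromℕ-* L (2 * q)) ⟨
  fromℕ (L * (2 * q)) ℚ.* r            ≤⟨ ℚ.*-monoʳ-≤-nonNeg r {{0≤r}} (fromℕ-mono-≤ L*2q≤) ⟩
  fromℕ (suc (2 * K) * (n C 2)) ℚ.* r  ≡⟨ cong (ℚ._* r) (fromℕ-* (suc (2 * K)) (n C 2)) ⟩
  fromℕ (suc (2 * K)) ℚ.* fromℕ (n C 2) ℚ.* r  <⟨ bound ⟩
  s                                    ∎)
  where
  open ℚ.≤-Reasoning
  pow′ : power n (ℚ.- (1/ fromℕ (suc (2 * b)))) r
  pow′ = subst (λ e → power n e r) (containerExponent≡ N b NC2≡1+b) pow
  0≤r : ℚ.NonNegative r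
  0≤r = ℚ.nonNegative (ℚ.<⇒≤ (proj₁ pow′))
  1≤2qr : 1ℚ ℚ.≤ fromℕ (2 * q) ℚ.* r
  1≤2qr = root-bound n (suc (2 * b)) (2 * q) n<[2q]^m (proj₁ pow′) (proj₂ pow′)
  L*2q≤ : L * (2 * q) ≤ suc (2 * K) * (n C 2)
  L*2q≤ = ≤-trans (≤-reflexive (rearrange L q)) (≤-trans (*-monoʳ-≤ 2 Lq≤KB)
    (≤-trans (≤-reflexive (sym (*-assoc 2 K (n C 2)))) (*-monoˡ-≤ (n C 2) (n≤1+n (2 * K)))))
    where
    rearrange : ∀ L q → L * (2 * q) ≡ 2 * (L * q)
    rearrange = solve-∀

-- The case without edges, and the theorem.

degenerate : ∀ k .{{_ : NonTrivial k}} N (ε : ℝ) → ¬ Edge N →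
  ∃[ C₀ ] ∃[ n₀ ] 0ℚ ℚ.< C₀ × 0 < n₀ ×
  (∀ (F : List (Colouring k N)) → F ≢ [] →
   ∀ (n : ℕ) .{{_ : NonZero n}} → n₀ ≤ n →
   ∃[ T ]
     IsContainerFamily T (Forb F n)
     × All (λ t → AtMost (fromℕ (n C N) · ℝ.upper ε) (ContainsMemberOf F t)) T
     × log k (length T) ≼ (C₀ ℚ.* fromℕ (n C 2)) · power n (containerExponent N))
degenerate k N ε noEdge = fromℕ 1 , suc N , fromℕ-mono-< {0} {1} z<s , z<s , λ F F≢[] n N<n →
  -- Without edges every restriction equals every member of `F`, so no colouring is free and the
  -- empty family works, with logarithm -∞.
  [] , (λ c forb → ⊥-elim (Forb-empty F F≢[] (<⇒≤ N<n) c forb)) , [] ,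
  λ s (r , (0<r , _) , bound) → log-< k {0} {0} z≤n (ℚ.≤-<-trans
    (0≤* (0≤* (0≤fromℕ 1) (0≤fromℕ (n C 2))) (ℚ.<⇒≤ 0<r)) bound)
  where
  Forb-empty : ∀ F → F ≢ [] → ∀ {n} → N ≤ n → ∀ c → ¬ Forb F n c
  Forb-empty []      F≢[] N≤n c forb = F≢[] refl
  Forb-empty (f ∷ F) F≢[] N≤n c forb
    with A , size , _ ← enumerate-surjective (λ i → Fin.inject≤ i N≤n)
           (λ {i} {j} → subst₂ _<_ (sym (Fin.toℕ-inject≤ i N≤n)) (sym (Fin.toℕ-inject≤ j N≤n)))
    = forb (A of-size size) (here λ e → ⊥-elim (noEdge e))

theorem2p6 : ∀ (k : ℕ) .{{_ : NonTrivial k}} (N : ℕ) (ε : ℝ) → Positiveℝ ε →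
    ∃[ C₀ ] ∃[ n₀ ] 0ℚ ℚ.< C₀ × 0 < n₀ ×
    (∀ (F : List (Colouring k N)) → F ≢ [] →
    ∀ (n : ℕ) .{{_ : NonZero n}} → n₀ ≤ n →
    ∃[ T ]
    IsContainerFamily T (Forb F n)
    × All (λ t → AtMost (fromℕ (n C N) · ℝ.upper ε) (ContainsMemberOf F t)) T
    × log k (length T) ≼ (C₀ ℚ.* fromℕ (n C 2)) · power n (containerExponent N))
theorem2p6 k zero       ε _   = degenerate k 0 ε λ ()
theorem2p6 k (suc zero) ε _   = degenerate k 1 ε λ { (edge zero zero ()) }
theorem2p6 k N@(suc (suc _)) ε ε>0 =
  let v , 1/v≤         = Positive⇒reciprocal ε ε>0
      b , NC2≡1+b      = positive-predecessor
      K , n₀ , containers = finite-containers k N b (suc v) (nonTrivial⇒n>1 k) z<s z<s NC2≡1+b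
  -- The successors make both constants positive in any case.
  in fromℕ (suc (2 * K)) , suc n₀ , fromℕ-mono-< {0} z<s , z<s , λ F _ n n₀<n →
     let T , covers , few , L , q , T≤k^L , n<[2q]^m , Lq≤ = containers F n (<⇒≤ n₀<n)
     in T , covers , All.map (atMost-· (n C N) v 1/v≤) few
        , log-bound k n N b {K} {L} {length T} {q} NC2≡1+b T≤k^L n<[2q]^m Lq≤
  where
  positive-predecessor : ∃[ b ] N C 2 ≡ suc b
  positive-predecessor with N C 2 | n*n≤4*nC2 {N} (s≤s (s≤s z≤n))
  ... | zero  | ()
  ... | suc b | _ = b , refl
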